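{- Let $D$ be a strongly connected balanced bipartite digraph of order $2a\geq 8$. Suppose that $\max\{d(x),d(y)\}\geq 2a-1$ for every pair of distinct vertices $x,y$ with a common out-neighbour. If $D$ is not isomorphic to the digraph $D(8)$, then $D$ is hamiltonian.
   Context: Digraphs are finite, without loops and without multiple arcs (a pair of opposite arcs $x\to y$, $y\to x$, called a 2-cycle $x\leftrightarrow y$, is allowed). For a vertex $x$, $d(x)=d^+(x)+d^-(x)$ is the sum of its out-degree and in-degree. A bipartite digraph with partite sets $X,Y$ is balanced if $|X|=|Y|$. A digraph is hamiltonian if it has a directed cycle through all its vertices. $D(8)$ is the bipartite digraph with partite sets $X=\{x_0,x_1,x_2,x_3\}$, $Y=\{y_0,y_1,y_2,y_3\}$ whose arc set consists exactly of the arcs $y_0x_1$, $y_1x_0$, $x_2y_3$, $x_3y_2$ together with both arcs of each of the 2-cycles $x_i\leftrightarrow y_i$ ($i=0,1,2,3$), $y_0\leftrightarrow x_2$, $y_0\leftrightarrow x_3$, $y_1\leftrightarrow x_2$, $y_1\leftrightarrow x_3$. -}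

module Defs where

open import Data.Nat using (ℕ; zero; suc; _+_; _≤_; _∸_; _*_)
open import Data.Fin using (Fin; zero; suc)
open import Data.Bool using (Bool; true; false; T)
open import Data.Sum using (_⊎_; inj₁; inj₂)
open import Data.Product using (Σ; ∃; _×_; _,_)
open import Data.List using (List; []; _∷_; length; filter; map; allFin; _++_)
open import Data.List.Relation.Unary.All using (All)
open import Relation.Nullary using (¬_)
open import Relation.Binary.PropositionalEquality using (_≡_)
open import Function.Bundles using (_↔_; Inverse)
open import Data.Nat using (_⊔_)

-- A bipartite digraph with partite sets X = Fin a and Y = Fin a (hence balanced).
-- Arcs are only between the two sides, so there are no loops; as arcs are given by
-- Boolean relations there are no multiple arcs; 2-cycles are allowed.
record BipDigraph (a : ℕ) : Set where
  field
    xy : Fin a → Fin a → Bool   -- xy i j = true  iff  arc x_i → y_j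
    yx : Fin a → Fin a → Bool   -- yx j i = true  iff  arc y_j → x_i

open BipDigraph public

Vertex : ℕ → Set
Vertex a = Fin a ⊎ Fin a     -- inj₁ i = x_i ∈ X,  inj₂ j = y_j ∈ Y

arcB : ∀ {a} → BipDigraph a → Vertex a → Vertex a → Bool
arcB D (inj₁ i) (inj₂ j) = xy D i j
arcB D (inj₂ j) (inj₁ i) = yx D j i
arcB D (inj₁ _) (inj₁ _) = false
arcB D (inj₂ _) (inj₂ _) = false

Arc : ∀ {a} → BipDigraph a → Vertex a → Vertex a → Set
Arc D u v = T (arcB D u v)

vertices : (a : ℕ) → List (Vertex a)
vertices a = map inj₁ (allFin a) ++ map inj₂ (allFin a)

countTrue : ∀ {A : Set} → (A → Bool) → List A → ℕ
countTrue p [] = 0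
countTrue p (x ∷ xs) with p x
... | true  = suc (countTrue p xs)
... | false = countTrue p xs

outdeg : ∀ {a} → BipDigraph a → Vertex a → ℕ
outdeg {a} D u = countTrue (λ v → arcB D u v) (vertices a)

indeg : ∀ {a} → BipDigraph a → Vertex a → ℕ
indeg {a} D u = countTrue (λ v → arcB D v u) (vertices a)

deg : ∀ {a} → BipDigraph a → Vertex a → ℕ
deg D u = outdeg D u + indeg D u

-- directed walk from u to v (a path exists iff a walk exists)
data Walk {a} (D : BipDigraph a) : Vertex a → Vertex a → Set where
  here : ∀ {u} → Walk D u u
  step : ∀ {u w v} → Arc D u w → Walk D w v → Walk D u v

StronglyConnected : ∀ {a} → BipDigraph a → Set
StronglyConnected {a} D = (u v : Vertex a) → Walk D u v

next : ∀ {n} → Fin n → Fin n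
next {suc n} i = Data.Fin.fromℕ< {m = suc (Data.Fin.toℕ i) Data.Nat.% suc n} (Data.Nat.DivMod.m%n<n (suc (Data.Fin.toℕ i)) (suc n))
  where import Data.Nat.DivMod

Hamiltonian : ∀ {a} → BipDigraph a → Set
Hamiltonian {a} D =
  Σ (Fin (a + a) ↔ Vertex a) λ σ →
    (i : Fin (a + a)) → Arc D (Inverse.to σ i) (Inverse.to σ (next i))

-- isomorphism of digraphs: a vertex bijection preserving and reflecting arcs
-- (not required to preserve the bipartition sides).
Isomorphic : ∀ {a b} → BipDigraph a → BipDigraph b → Set
Isomorphic {a} {b} D E =
  Σ (Vertex a ↔ Vertex b) λ φ →
    (u v : Vertex a) → arcB D u v ≡ arcB E (Inverse.to φ u) (Inverse.to φ v)

D8xy : Fin 4 → Fin 4 → Bool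
D8xy zero zero = true
D8xy (suc zero) (suc zero) = true
D8xy (suc (suc zero)) (suc (suc zero)) = true
D8xy (suc (suc (suc zero))) (suc (suc (suc zero))) = true
D8xy (suc (suc zero)) zero = true
D8xy (suc (suc (suc zero))) zero = true
D8xy (suc (suc zero)) (suc zero) = true
D8xy (suc (suc (suc zero))) (suc zero) = true
D8xy (suc (suc zero)) (suc (suc (suc zero))) = true
D8xy (suc (suc (suc zero))) (suc (suc zero)) = true
D8xy _ _ = false

D8yx : Fin 4 → Fin 4 → Bool
D8yx zero zero = true
D8yx (suc zero) (suc zero) = true
D8yx (suc (suc zero)) (suc (suc zero)) = true
D8yx (suc (suc (suc zero))) (suc (suc (suc zero))) = true
D8yx zero (suc (suc zero)) = true
D8yx zero (suc (suc (suc zero))) = true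
D8yx (suc zero) (suc (suc zero)) = true
D8yx (suc zero) (suc (suc (suc zero))) = true
D8yx zero (suc zero) = true
D8yx (suc zero) zero = true
D8yx _ _ = false

D8 : BipDigraph 4
D8 = record { xy = D8xy ; yx = D8yx }

{-# OPTIONS --safe #-}
module Submission where

-- Call a vertex big if its degree is at least 2a − 1, so that at most one of its possible arcs
-- is missing, and small otherwise.  Small vertices on one side have disjoint out-neighbourhoods.
-- If one side has no big vertex, every in-degree is 1 and D is a directed cycle.  Otherwise a big
-- vertex opposite a side allows at most two small vertices on that side.  Any two big
-- vertices x, y outside a cycle of length at least 4 can be inserted into it as a pair, so a cycle
-- of length at least 4 through all small vertices extends to a Hamiltonian one.  A case analysis
-- on the at most two small vertices of each side finds such a cycle (of length at most 10), except
-- when a = 4, both sides have two small vertices and no arc joins small vertices: this is D(8).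

open import Defs
open import Data.Nat using (ℕ; zero; suc; _≤_; _<_; _+_; _*_; _∸_; _⊔_; z≤n; s≤s; _≤?_; _<?_)
open import Data.Nat.DivMod using (_%_; _/_; m≡m%n+[m/n]*n; m%n<n; m<n⇒m%n≡m; n%n≡0)
open import Data.Nat.GeneralisedArithmetic using (fold; fold-+)
import Data.Nat.Properties as ℕ
open import Data.Bool using (Bool; true; false; T)
open import Data.Bool.Properties using (T?)
open import Data.Empty using (⊥)
open import Data.Fin using (Fin; zero; suc; toℕ; fromℕ<; join; splitAt)
open import Data.Fin.Properties
  using (_≟_; any?; injective⇒≤; pigeonhole; toℕ<n; toℕ-fromℕ<; splitAt-join; join-splitAt)
open import Data.List using (List; []; _∷_; length; lookup; map; allFin; _++_)
open import Data.List.Membership.Propositional using (_∈_; _∉_)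
open import Data.List.Membership.DecPropositional using () renaming (_∈?_ to mem?)
open import Data.List.Membership.Propositional.Properties using (∈-lookup; ∈-allFin; ∈-tabulate⁻)
open import Data.List.Properties using (length-map; length-tabulate)
open import Data.List.Relation.Unary.All using (All; []; _∷_)
import Data.List.Relation.Unary.All as All
import Data.List.Relation.Binary.Permutation.Setoid.Properties as ↭ₛ
open import Data.List.Relation.Unary.All.Properties using (¬Any⇒All¬)
open import Data.List.Relation.Unary.AllPairs as AllPairs using ([]; _∷_)
open import Data.List.Relation.Unary.Any using (here; there; index)
open import Data.List.Relation.Unary.Any.Properties using (lookup-index)
open import Data.List.Relation.Unary.Unique.Propositional using (Unique)
open import Data.List.Relation.Unary.Unique.Propositional.Properties using (tabulate⁺)
open import Data.List.Relation.Binary.Permutation.Propositional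
  using (_↭_; ↭-sym; ↭-refl; ↭⇒↭ₛ)
open import Data.List.Relation.Binary.Permutation.Propositional.Properties
  using (∈-resp-↭; shift)
open import Data.Product using (Σ; ∃; ∃₂; _×_; _,_; proj₁; proj₂)
open import Data.Sum using (_⊎_; inj₁; inj₂; [_,_]′)
open import Data.Sum.Function.Propositional using (_⊎-↔_)
open import Data.Sum.Properties using (≡-dec; inj₁-injective; inj₂-injective)
open import Function using (_∘_; id)
open import Function.Bundles using (_↔_; Inverse; mk↔ₛ′)
open import Function.Properties.Inverse using (↔-sym)
open import Relation.Nullary using (¬_; Dec; yes; no; ¬?; contradiction)
open import Relation.Nullary.Decidable using (decidable-stable; _×-dec_; _⊎-dec_)
open import Relation.Unary using (Decidable)
open import Relation.Binary.PropositionalEquality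
  using (_≡_; _≢_; refl; sym; trans; cong; cong₂; subst; ≢-sym; setoid)

-- Repetition-free lists over a finite set.

_∈?_ : ∀ {n} (x : Fin n) (l : List (Fin n)) → Dec (x ∈ l)
_∈?_ = mem? _≟_

Unique-resp-↭ : ∀ {A : Set} {xs ys : List A} → xs ↭ ys → Unique xs → Unique ys
Unique-resp-↭ {A} p = ↭ₛ.Unique-resp-↭ (setoid A) (↭⇒↭ₛ p)

fresh : ∀ {n} (l : List (Fin n)) → length l < n → ∃ λ x → x ∉ l
fresh {n} l l<n with any? (λ x → ¬? (x ∈? l))
... | yes p = p
... | no ¬p = contradiction (injective⇒≤ inj) (ℕ.<⇒≱ l<n)
  where
  mem : ∀ x → x ∈ l
  mem x = decidable-stable (x ∈? l) (λ x∉l → ¬p (x , x∉l))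
  inj : ∀ {x y} → index (mem x) ≡ index (mem y) → x ≡ y
  inj {x} {y} e =
    trans (lookup-index (mem x)) (trans (cong (lookup l) e) (sym (lookup-index (mem y))))

lookup-injective : ∀ {A : Set} {l : List A} → Unique l → ∀ {i j} → lookup l i ≡ lookup l j → i ≡ j
lookup-injective (p ∷ u) {zero} {zero} e = refl
lookup-injective {l = _ ∷ l} (p ∷ u) {zero} {suc j} e =
  contradiction e (All.lookup p (∈-lookup j))
lookup-injective {l = _ ∷ l} (p ∷ u) {suc i} {zero} e =
  contradiction (sym e) (All.lookup p (∈-lookup i))
lookup-injective (p ∷ u) {suc i} {suc j} e = cong suc (lookup-injective u e)

full : ∀ {n} {l : List (Fin n)} → Unique l → length l ≡ n → ∀ x → x ∈ l
full {l = l} u e x = decidable-stable (x ∈? l) λ x∉l →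
  ℕ.<-irrefl e (injective⇒≤ (lookup-injective (¬Any⇒All¬ l x∉l ∷ u)))

unique₂ : ∀ {A : Set} {x y : A} → x ≢ y → Unique (x ∷ y ∷ [])
unique₂ p = (p ∷ []) ∷ [] ∷ []

unique₃ : ∀ {A : Set} {x y z : A} → x ≢ y → x ≢ z → y ≢ z → Unique (x ∷ y ∷ z ∷ [])
unique₃ p q r = (p ∷ q ∷ []) ∷ unique₂ r

unique₄ : ∀ {A : Set} {x y z w : A} → x ≢ y → x ≢ z → x ≢ w → y ≢ z → y ≢ w → z ≢ w →
  Unique (x ∷ y ∷ z ∷ w ∷ [])
unique₄ p q r s t v = (p ∷ q ∷ r ∷ []) ∷ unique₃ s t v

unique₅ : ∀ {A : Set} {x y z w v : A} → x ≢ y → x ≢ z → x ≢ w → x ≢ v →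
  y ≢ z → y ≢ w → y ≢ v → z ≢ w → z ≢ v → w ≢ v → Unique (x ∷ y ∷ z ∷ w ∷ v ∷ [])
unique₅ p q r s t u v w x y = (p ∷ q ∷ r ∷ s ∷ []) ∷ unique₄ t u v w x y

-- Vertices with at most one missing arc, and the abstract setting.

record Saturated {a} (P Q : Fin a → Fin a → Bool) (x : Fin a) : Set where
  field
    -- Each field turns one missing arc at `x` into the presence of others; together they say that
    -- at most one of the 2a possible arcs at `x` is missing.
    out-out : ∀ {y y'} → ¬ T (P x y) → y' ≢ y → T (P x y')
    out-in : ∀ {y y'} → ¬ T (P x y) → T (Q y' x)
    in-in : ∀ {y y'} → ¬ T (Q y x) → y' ≢ y → T (Q y' x)
    in-out : ∀ {y y'} → ¬ T (Q y x) → T (P x y')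

open Saturated

-- BX and BY abstract the vertices of degree at least 2a - 1.
record Config (a : ℕ) : Set₁ where
  field
    P Q : Fin a → Fin a → Bool
    BX BY : Fin a → Set
    BX? : Decidable BX
    BY? : Decidable BY
    4≤a : 4 ≤ a
    satX : ∀ {x} → BX x → Saturated P Q x
    satY : ∀ {y} → BY y → Saturated Q P y

  _⟶_ : Fin a → Fin a → Set
  x ⟶ y = T (P x y)

  _⟿_ : Fin a → Fin a → Set
  y ⟿ x = T (Q y x)

  field
    domX : ∀ {x x' y} → x ≢ x' → x ⟶ y → x' ⟶ y → BX x ⊎ BX x'
    domY : ∀ {y y' x} → y ≢ y' → y ⟿ x → y' ⟿ x → BY y ⊎ BY y'
    outX : ∀ x → ∃ λ y → x ⟶ y
    inX : ∀ x → ∃ λ y → y ⟿ x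
    outY : ∀ y → ∃ λ x → y ⟿ x
    inY : ∀ y → ∃ λ x → x ⟶ y
    -- `escape` and `enter` are strong connectivity for the set of `x` and `y`: some arc leaves it
    -- and some arc enters it.
    escape : ∀ x y → (∃ λ x' → x' ≢ x × y ⟿ x') ⊎ (∃ λ y' → y' ≢ y × x ⟶ y')
    enter : ∀ x y → (∃ λ x' → x' ≢ x × x' ⟶ y) ⊎ (∃ λ y' → y' ≢ y × y' ⟿ x)

-- Only the sides are exchanged; every arc keeps its direction. A result about X thus yields its
-- mirror image about Y.
dual : ∀ {a} → Config a → Config a
dual I = record
  { P = Q ; Q = P ; BX = BY ; BY = BX ; BX? = BY? ; BY? = BX? ; 4≤a = 4≤a
  ; satX = satY ; satY = satX ; domX = domY ; domY = domX
  ; outX = outY ; inX = inY ; outY = outX ; inY = inX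
  ; escape = λ y x → [ inj₂ , inj₁ ]′ (escape x y)
  ; enter = λ y x → [ inj₂ , inj₁ ]′ (enter x y) }
  where open Config I

-- Cycles containing every small vertex, and their extension.

Through : ∀ {a} (I : Config a) → List (Fin a) → Fin a → Set
Through I L x = ∃₂ λ y y' → y ∉ L × y' ∉ L × y ≢ y' × x ⟶ y × y' ⟿ x
  where open Config I

module _ {a} (I : Config a) where
  open Config I

  Closed : Fin a → List (Fin a × Fin a) → Set
  Closed z [] = ⊥
  Closed z ((x , y) ∷ []) = x ⟶ y × y ⟿ z
  Closed z ((x , y) ∷ l@((x' , _) ∷ _)) = x ⟶ y × y ⟿ x' × Closed z l

  -- The pairs (x₁ , y₁) ∷ (x₂ , y₂) ∷ … stand for the cycle x₁ → y₁ → x₂ → y₂ → … → x₁.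
  record Cycle (n : ℕ) : Set where
    constructor cycle
    field
      x₁ y₁ x₂ y₂ : Fin a
      rest : List (Fin a × Fin a)

    arcs : List (Fin a × Fin a)
    arcs = (x₁ , y₁) ∷ (x₂ , y₂) ∷ rest

    xs : List (Fin a)
    xs = map proj₁ arcs

    ys : List (Fin a)
    ys = map proj₂ arcs

    field
      size : length arcs ≡ n
      closed : Closed x₁ arcs
      uniqueX : Unique xs
      uniqueY : Unique ys
      -- All vertices off the cycle are big, so `insert` applies at every stage of `grow`.
      remX : ∀ {x} → x ∉ xs → BX x
      remY : ∀ {y} → y ∉ ys → BY y

  Cover : Set
  Cover = ∃ Cycle

  -- The new vertex lists are permutations of the old ones with `x` and `y` added, so distinctness
  -- and bigness of the remaining vertices carry over wherever the pair went.
  rearrange : ∀ {n x y} (c : Cycle n) → let open Cycle c in x ∉ xs → y ∉ ys →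
    ∀ x₁' y₁' x₂' y₂' rest' → let arcs' = (x₁' , y₁') ∷ (x₂' , y₂') ∷ rest' in
    length rest' ≡ suc (length rest) → Closed x₁' arcs' →
    map proj₁ arcs' ↭ x ∷ xs → map proj₂ arcs' ↭ y ∷ ys → Cycle (suc n)
  rearrange {n} {x} {y} c x∉ y∉ x₁' y₁' x₂' y₂' rest' e closed' px py = record
    { x₁ = x₁' ; y₁ = y₁' ; x₂ = x₂' ; y₂ = y₂' ; rest = rest'
    ; size = trans (cong (2 +_) e) (cong suc size)
    ; closed = closed'
    ; uniqueX = Unique-resp-↭ (↭-sym px) (¬Any⇒All¬ xs x∉ ∷ uniqueX)
    ; uniqueY = Unique-resp-↭ (↭-sym py) (¬Any⇒All¬ ys y∉ ∷ uniqueY)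
    ; remX = λ n∈ → remX (λ m → n∈ (∈-resp-↭ (↭-sym px) (there m)))
    ; remY = λ n∈ → remY (λ m → n∈ (∈-resp-↭ (↭-sym py) (there m))) }
    where open Cycle c

  closed-tail : ∀ {z x x' y' l} → x ⟶ y' → Closed z ((x' , y') ∷ l) → Closed z ((x , y') ∷ l)
  closed-tail {l = []} p (_ , q) = p , q
  closed-tail {l = _ ∷ _} p (_ , q) = p , q

  -- A missing arc saturates both its ends, so the pair fits into one of the first
  -- three arcs x₁ → y₁ → x₂ → y₂ of the cycle.
  insert : ∀ {n x y} (c : Cycle n) → let open Cycle c in x ∉ xs → y ∉ ys → Cycle (suc n)
  insert {n} {x} {y} c x∉ y∉ = go
    where
    open Cycle c
    satx = satX (remX x∉)
    saty = satY (remY y∉)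

    c₁ : x₁ ⟶ y₁
    c₁ = proj₁ closed
    c₂ : y₁ ⟿ x₂
    c₂ = proj₁ (proj₂ closed)
    c₃ : Closed x₁ ((x₂ , y₂) ∷ rest)
    c₃ = proj₂ (proj₂ closed)

    at-x₁y₁ : x₁ ⟶ y → y ⟿ x → x ⟶ y₁ → Cycle (suc n)
    at-x₁y₁ p q r = rearrange c x∉ y∉ x₁ y x y₁ ((x₂ , y₂) ∷ rest) refl
      (p , q , r , c₂ , c₃) (shift x (x₁ ∷ []) _) ↭-refl

    at-y₁x₂ : y₁ ⟿ x → x ⟶ y → y ⟿ x₂ → Cycle (suc n)
    at-y₁x₂ p q r = rearrange c x∉ y∉ x₁ y₁ x y ((x₂ , y₂) ∷ rest) refl
      (c₁ , p , q , r , c₃) (shift x (x₁ ∷ []) _) (shift y (y₁ ∷ []) _)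

    at-x₂y₂ : x₂ ⟶ y → y ⟿ x → x ⟶ y₂ → Cycle (suc n)
    at-x₂y₂ p q r = rearrange c x∉ y∉ x₁ y₁ x₂ y ((x , y₂) ∷ rest) refl
      (c₁ , c₂ , p , q , closed-tail r c₃)
      (shift x (x₁ ∷ x₂ ∷ []) _) (shift y (y₁ ∷ []) _)

    go : Cycle (suc n)
    go with T? (Q y x) | T? (P x₁ y) | T? (P x y₁) | T? (P x₂ y) | T? (P x y₂)
    -- Here `y → x` is the one missing arc of both `x` and `y`, so y₁ → x → y → x₂ is available.
    ... | no ¬q | _ | _ | _ | _ =
          at-y₁x₂ (in-in satx ¬q (λ e → y∉ (here (sym e)))) (in-out satx ¬q)
            (out-out saty ¬q (λ e → x∉ (there (here (sym e)))))
    ... | yes q | yes p | yes r | _ | _ = at-x₁y₁ p q r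
    ... | yes q | _ | _ | yes p | yes r = at-x₂y₂ p q r
    ... | yes q | no ¬p | _ | no ¬p' | _ =
          contradiction (in-in saty ¬p (≢-sym (All.head (AllPairs.head uniqueX)))) ¬p'
    ... | yes q | _ | no ¬r | _ | no ¬r' =
          contradiction (out-out satx ¬r (≢-sym (All.head (AllPairs.head uniqueY)))) ¬r'
    -- Both x₁ → y → x → y₁ and x₂ → y → x → y₂ fail. Neither `x` nor `y` misses two arcs, so `y`
    -- misses an arc from the cycle and `x` an arc to it; all of y₁ → x → y → x₂ is then present.
    ... | yes q | no ¬p | _ | yes _ | no ¬r =
          at-y₁x₂ (out-in satx ¬r) (out-out satx ¬r (λ e → y∉ (there (here e)))) (in-out saty ¬p)
    ... | yes q | yes _ | no ¬r | no ¬p | _ =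
          at-y₁x₂ (out-in satx ¬r) (out-out satx ¬r (λ e → y∉ (here e))) (in-out saty ¬p)

  grow : ∀ {n} k → k + n ≡ a → Cycle n → Cycle a
  grow zero refl c = c
  grow {n} (suc k) e c with fresh xs xs<a | fresh ys ys<a
    where
    open Cycle c
    n<a : n < a
    n<a = subst (n <_) e (s≤s (ℕ.m≤n+m n k))
    xs<a : length xs < a
    xs<a = subst (_< a) (sym (trans (length-map proj₁ arcs) size)) n<a
    ys<a : length ys < a
    ys<a = subst (_< a) (sym (trans (length-map proj₂ arcs) size)) n<a
  ... | x , x∉ | y , y∉ = grow k (trans (ℕ.+-suc k n) e) (insert c x∉ y∉)

  size≤ : ∀ {n} → Cycle n → n ≤ a
  size≤ c = subst (_≤ a) (trans (length-map proj₁ arcs) size) (injective⇒≤ (lookup-injective uniqueX))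
    where open Cycle c

  spanning : Cover → Cycle a
  spanning (n , c) = grow (a ∸ n) (ℕ.m∸n+n≡m (size≤ c)) c

  rem⁺ : ∀ {B : Fin a → Set} {x₀} {l : List (Fin a)} →
    (∀ {x} → x ≢ x₀ → B x) → x₀ ∈ l → ∀ {x} → x ∉ l → B x
  rem⁺ b m x∉ = b λ { refl → x∉ m }

  -- If `u` and `v` coincide, take another vertex `z` outside `L`: either `x → z` supplies a second
  -- out-neighbour, or that missing arc forces `z → x`, a second in-neighbour.
  spread : ∀ (L : List (Fin a)) → suc (length L) < a → (∀ {y} → y ∉ L → BY y) →
    ∀ {x u v} → u ∉ L → x ⟶ u → v ∉ L → v ⟿ x → Through I L x
  spread L L<a big {x} {u} {v} u∉ xu v∉ vx with u ≟ v
  ... | no u≢v = u , v , u∉ , v∉ , u≢v , xu , vx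
  ... | yes refl with fresh (u ∷ L) L<a
  ...   | z , z∉ with T? (P x z)
  ...     | yes xz = z , u , (λ m → z∉ (there m)) , u∉ , (λ e → z∉ (here e)) , xz , vx
  ...     | no ¬xz = u , z , u∉ , (λ m → z∉ (there m)) , (λ e → z∉ (here (sym e))) , xu ,
                     in-out (satY (big (λ m → z∉ (there m)))) ¬xz

  -- One exceptional vertex on each side.
  module OneOne {x₀ y₀ : Fin a} (bigX : ∀ {x} → x ≢ x₀ → BX x) (bigY : ∀ {y} → y ≢ y₀ → BY y) where

    -- If `y₀` is the only out-neighbour of `x₀`, every other `u` has its missing arc at `x₀`, and
    -- x₀ → y₀ → x' → u → x₀ closes up with `x'` from `escape`. If `y₀` is the only in-neighbour,
    -- `enter` gives x₀ → u → x' → y₀ → x₀. Otherwise `spread` applies.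
    through : Cover ⊎ Through I (y₀ ∷ []) x₀
    through with any? (λ y → ¬? (y ≟ y₀) ×-dec T? (P x₀ y))
               | any? (λ y → ¬? (y ≟ y₀) ×-dec T? (Q y x₀))
    ... | yes (u , u≢ , xu) | yes (v , v≢ , vx) =
          inj₂ (spread (y₀ ∷ []) (ℕ.≤-trans (s≤s (s≤s (s≤s z≤n))) 4≤a) (λ n → bigY (λ e → n (here e)))
            (λ { (here e) → u≢ e }) xu (λ { (here e) → v≢ e }) vx)
    ... | no ¬out | _ = inj₁ (go (escape x₀ y₀))
      where
      only : ∀ {y} → x₀ ⟶ y → y ≡ y₀
      only {y} p = decidable-stable (y ≟ y₀) λ ne → ¬out (y , ne , p)
      x₀y₀ : x₀ ⟶ y₀
      x₀y₀ with outX x₀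
      ... | y , p with only p
      ... | refl = p
      go : (∃ λ x' → x' ≢ x₀ × y₀ ⟿ x') ⊎ (∃ λ y' → y' ≢ y₀ × x₀ ⟶ y') → Cover
      go (inj₂ (y' , ne , p)) = contradiction (only p) ne
      go (inj₁ (x' , x'≢ , p)) with fresh (y₀ ∷ []) (ℕ.≤-trans (s≤s (s≤s z≤n)) 4≤a)
      ... | u , u∉ = _ , cycle x₀ y₀ x' u [] refl
            (x₀y₀ , p , in-in satu ¬x₀u x'≢ , in-out satu ¬x₀u)
            (unique₂ (≢-sym x'≢)) (unique₂ (≢-sym u≢)) (rem⁺ bigX (here refl)) (rem⁺ bigY (here refl))
        where
        u≢ : u ≢ y₀
        u≢ e = u∉ (here e)
        satu = satY (bigY u≢)
        ¬x₀u : ¬ x₀ ⟶ u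
        ¬x₀u q = u≢ (only q)
    ... | yes _ | no ¬in = inj₁ (go (enter x₀ y₀))
      where
      only : ∀ {y} → y ⟿ x₀ → y ≡ y₀
      only {y} p = decidable-stable (y ≟ y₀) λ ne → ¬in (y , ne , p)
      y₀x₀ : y₀ ⟿ x₀
      y₀x₀ with inX x₀
      ... | y , p with only p
      ... | refl = p
      go : (∃ λ x' → x' ≢ x₀ × x' ⟶ y₀) ⊎ (∃ λ y' → y' ≢ y₀ × y' ⟿ x₀) → Cover
      go (inj₂ (y' , ne , p)) = contradiction (only p) ne
      go (inj₁ (x' , x'≢ , p)) with fresh (y₀ ∷ []) (ℕ.≤-trans (s≤s (s≤s z≤n)) 4≤a)
      ... | u , u∉ = _ , cycle x₀ u x' y₀ [] refl
            (out-in satu ¬ux₀ , out-out satu ¬ux₀ x'≢ , p , y₀x₀)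
            (unique₂ (≢-sym x'≢)) (unique₂ u≢) (rem⁺ bigX (here refl)) (rem⁺ bigY (there (here refl)))
        where
        u≢ : u ≢ y₀
        u≢ e = u∉ (here e)
        satu = satY (bigY u≢)
        ¬ux₀ : ¬ u ⟿ x₀
        ¬ux₀ q = u≢ (only q)

    -- The target is the 6-cycle x₀ y x y₀ x' y', which lacks at most `y → x` and `x' → y'`. If both
    -- are missing, their ends are saturated and x₀ y' x' y₀ x y works. If one is missing, it is
    -- replaced by a detour through fresh `x″` and `y″`; should the arc between these be missing as
    -- well, it saturates them and a 6-cycle through `x″` and `y″` exists.
    link : Through I (y₀ ∷ []) x₀ → Through (dual I) (x₀ ∷ []) y₀ → Cover
    link (y , y' , y∉ , y'∉ , y≢y' , x₀y , y'x₀) (x' , x , x'∉ , x∉ , x'≢x , y₀x' , xy₀)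
      with fresh (x₀ ∷ x ∷ x' ∷ []) 4≤a | fresh (y₀ ∷ y ∷ y' ∷ []) 4≤a
    ... | x″ , x″∉ | y″ , y″∉ = go
      where
      y≢ : y ≢ y₀
      y≢ e = y∉ (here e)
      y'≢ : y' ≢ y₀
      y'≢ e = y'∉ (here e)
      y″≢ : y″ ≢ y₀
      y″≢ e = y″∉ (here e)
      y″≢y : y″ ≢ y
      y″≢y e = y″∉ (there (here e))
      y″≢y' : y″ ≢ y'
      y″≢y' e = y″∉ (there (there (here e)))
      x≢ : x ≢ x₀
      x≢ e = x∉ (here e)
      x'≢ : x' ≢ x₀
      x'≢ e = x'∉ (here e)
      x″≢ : x″ ≢ x₀
      x″≢ e = x″∉ (here e)
      x″≢x : x″ ≢ x
      x″≢x e = x″∉ (there (here e))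
      x″≢x' : x″ ≢ x'
      x″≢x' e = x″∉ (there (there (here e)))
      x≢x' : x ≢ x'
      x≢x' = ≢-sym x'≢x
      sx = satX (bigX x≢)
      sx' = satX (bigX x'≢)
      sx″ = satX (bigX x″≢)
      sy = satY (bigY y≢)
      sy' = satY (bigY y'≢)
      sy″ = satY (bigY y″≢)

      go : Cover
      go with T? (Q y x) | T? (P x' y') | T? (P x″ y″) | T? (Q y″ x″)
      ... | yes yx | yes x'y' | _ | _ = _ , cycle x₀ y x y₀ ((x' , y') ∷ []) refl
            (x₀y , yx , xy₀ , y₀x' , x'y' , y'x₀)
            (unique₃ (≢-sym x≢) (≢-sym x'≢) x≢x') (unique₃ y≢ y≢y' (≢-sym y'≢))
            (rem⁺ bigX (here refl)) (rem⁺ bigY (there (here refl)))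
      ... | no ¬yx | no ¬x'y' | _ | _ = _ , cycle x₀ y' x' y₀ ((x , y) ∷ []) refl
            (in-in sy' ¬x'y' (≢-sym x'≢) , in-out sy' ¬x'y' , out-out sx' ¬x'y' (≢-sym y'≢) ,
             in-in sx ¬yx (≢-sym y≢) , in-out sx ¬yx , out-out sy ¬yx (≢-sym x≢))
            (unique₃ (≢-sym x'≢) (≢-sym x≢) x'≢x) (unique₃ y'≢ (≢-sym y≢y') (≢-sym y≢))
            (rem⁺ bigX (here refl)) (rem⁺ bigY (there (here refl)))
      ... | no ¬yx | yes x'y' | yes x″y″ | _ = _ , cycle x₀ y x″ y″ ((x , y₀) ∷ (x' , y') ∷ []) refl
            (x₀y , out-out sy ¬yx x″≢x , x″y″ , in-in sx ¬yx y″≢y , xy₀ , y₀x' , x'y' , y'x₀)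
            (unique₄ (≢-sym x″≢) (≢-sym x≢) (≢-sym x'≢) x″≢x x″≢x' x≢x')
            (unique₄ (≢-sym y″≢y) y≢ y≢y' y″≢ y″≢y' (≢-sym y'≢))
            (rem⁺ bigX (here refl)) (rem⁺ bigY (there (there (here refl))))
      ... | no ¬yx | yes x'y' | no ¬x″y″ | _ = _ , cycle x₀ y x″ y₀ ((x , y″) ∷ []) refl
            (x₀y , out-out sy ¬yx x″≢x , out-out sx″ ¬x″y″ (≢-sym y″≢) , in-in sx ¬yx (≢-sym y≢) ,
             in-out sx ¬yx , in-out sy″ ¬x″y″)
            (unique₃ (≢-sym x″≢) (≢-sym x≢) x″≢x) (unique₃ y≢ (≢-sym y″≢y) (≢-sym y″≢))
            (rem⁺ bigX (here refl)) (rem⁺ bigY (there (here refl)))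
      ... | yes yx | no ¬x'y' | _ | yes y″x″ = _ , cycle x₀ y x y₀ ((x' , y″) ∷ (x″ , y') ∷ []) refl
            (x₀y , yx , xy₀ , y₀x' , out-out sx' ¬x'y' y″≢y' , y″x″ , in-in sy' ¬x'y' x″≢x' , y'x₀)
            (unique₄ (≢-sym x≢) (≢-sym x'≢) (≢-sym x″≢) x≢x' (≢-sym x″≢x) (≢-sym x″≢x'))
            (unique₄ y≢ (≢-sym y″≢y) y≢y' (≢-sym y″≢) (≢-sym y'≢) y″≢y')
            (rem⁺ bigX (here refl)) (rem⁺ bigY (there (here refl)))
      ... | yes yx | no ¬x'y' | _ | no ¬y″x″ = _ , cycle x₀ y″ x' y₀ ((x″ , y') ∷ []) refl
            (out-in sy″ ¬y″x″ , out-out sy″ ¬y″x″ (≢-sym x″≢x') , out-out sx' ¬x'y' (≢-sym y'≢) ,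
             in-in sx″ ¬y″x″ (≢-sym y″≢) , in-in sy' ¬x'y' x″≢x' , y'x₀)
            (unique₃ (≢-sym x'≢) (≢-sym x″≢) (≢-sym x″≢x')) (unique₃ y″≢ y″≢y' (≢-sym y'≢))
            (rem⁺ bigX (here refl)) (rem⁺ bigY (there (here refl)))

-- Labellings by D(8) and pairs of small vertices.

enumerate : ∀ {n} {l : List (Fin n)} → Unique l → length l ≡ n → Fin (length l) ↔ Fin n
enumerate {l = l} u e = mk↔ₛ′ (lookup l) (λ x → index (full u e x))
  (λ x → sym (lookup-index (full u e x)))
  (λ i → lookup-injective u (sym (lookup-index (full u e (lookup l i)))))

T⇒≡true : ∀ {b} → T b → b ≡ true
T⇒≡true {true} _ = refl

¬T⇒≡false : ∀ {b} → ¬ T b → b ≡ false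
¬T⇒≡false {false} _ = refl
¬T⇒≡false {true} ¬t = contradiction _ ¬t

-- An isomorphism with D(8) that respects the sides, phrased on `Config` so that the case analysis
-- can produce it.
D8Labelling : ∀ {a} → Config a → Set
D8Labelling {a} I = Σ (Fin 4 ↔ Fin a) λ ξ → Σ (Fin 4 ↔ Fin a) λ η →
  (∀ i j → P (Inverse.to ξ i) (Inverse.to η j) ≡ D8xy i j) ×
  (∀ j i → Q (Inverse.to η j) (Inverse.to ξ i) ≡ D8yx j i)
  where open Config I

record SmallPair {a} (I : Config a) : Set where
  open Config I
  field
    x₀ x₁ : Fin a
    x₀≢x₁ : x₀ ≢ x₁
    small₀ : ¬ BX x₀
    small₁ : ¬ BX x₁
    others : ∀ {x} → x ≢ x₀ → x ≢ x₁ → BX x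

  disjoint : ∀ {y} → x₀ ⟶ y → ¬ x₁ ⟶ y
  disjoint p q = [ small₀ , small₁ ]′ (domX x₀≢x₁ p q)

  disjoint≢ : ∀ {y y'} → x₀ ⟶ y → x₁ ⟶ y' → y ≢ y'
  disjoint≢ p q refl = disjoint p q

  covered : ∀ {l : List (Fin a)} → x₀ ∈ l → x₁ ∈ l → ∀ {x} → x ∉ l → BX x
  covered m n x∉ = others (λ { refl → x∉ m }) (λ { refl → x∉ n })

  -- The small vertices share no out-neighbour, so a big `y` spends its only missing arc on one of
  -- them. Hence the next three lemmas: `y` reaches all of X, and only an arc from `x₀` or `x₁` into
  -- `y` can be absent.
  misses : ∀ {y} → BY y → ¬ x₀ ⟶ y ⊎ ¬ x₁ ⟶ y
  misses {y} b with T? (P x₀ y)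
  ... | yes p = inj₂ (disjoint p)
  ... | no ¬p = inj₁ ¬p

  toAll : ∀ {y x} → BY y → y ⟿ x
  toAll b = [ in-out (satY b) , in-out (satY b) ]′ (misses b)

  fromBig : ∀ {y x} → BY y → x ≢ x₀ → x ≢ x₁ → x ⟶ y
  fromBig b n₀ n₁ = [ (λ m → in-in (satY b) m n₀) , (λ m → in-in (satY b) m n₁) ]′ (misses b)

  fromOther : ∀ {y} → BY y → ¬ x₁ ⟶ y → x₀ ⟶ y
  fromOther b m = in-in (satY b) m x₀≢x₁

  private
    pick₀ : ∃ λ w → w ∉ x₀ ∷ x₁ ∷ []
    pick₀ = fresh _ (ℕ.≤-trans (s≤s (s≤s (s≤s z≤n))) 4≤a)

    pick₁ : ∃ λ w → w ∉ x₀ ∷ x₁ ∷ proj₁ pick₀ ∷ []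
    pick₁ = fresh _ 4≤a

  w₀ w₁ : Fin a
  w₀ = proj₁ pick₀
  w₁ = proj₁ pick₁

  w₀≢x₀ : w₀ ≢ x₀
  w₀≢x₀ e = proj₂ pick₀ (here e)

  w₀≢x₁ : w₀ ≢ x₁
  w₀≢x₁ e = proj₂ pick₀ (there (here e))

  w₁≢x₀ : w₁ ≢ x₀
  w₁≢x₀ e = proj₂ pick₁ (here e)

  w₁≢x₁ : w₁ ≢ x₁
  w₁≢x₁ e = proj₂ pick₁ (there (here e))

  w₁≢w₀ : w₁ ≢ w₀
  w₁≢w₀ e = proj₂ pick₁ (there (there (here e)))

exchange : ∀ {a} {I : Config a} → SmallPair I → SmallPair I
exchange p = record
  { x₀ = x₁ ; x₁ = x₀ ; x₀≢x₁ = ≢-sym x₀≢x₁ ; small₀ = small₁ ; small₁ = small₀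
  ; others = λ m n → others n m }
  where open SmallPair p

-- `dual (dual I)` swaps the sums in `escape` and `enter` twice, which does not reduce to `I`. A
-- pair involves neither field, so its data carry over verbatim.
undual : ∀ {a} {I : Config a} → SmallPair I → SmallPair (dual (dual I))
undual p = record
  { x₀ = x₀ ; x₁ = x₁ ; x₀≢x₁ = x₀≢x₁ ; small₀ = small₀ ; small₁ = small₁ ; others = others }
  where open SmallPair p

-- Two small vertices x₀, x₁ on one side, at most one (y₀) on the other.
module TwoOne {a} (I : Config a) {y₀ : Fin a} (bigY : ∀ {y} → y ≢ y₀ → Config.BY I y) where
  open Config I

  -- The 6-cycle x₀ y₀ w u₀ x₁ u₁, for a `y₀` entered only from the small pair.
  viaFirst : (p : SmallPair I) → let open SmallPair p in ∀ {w u₀ u₁} → x₀ ⟶ y₀ → y₀ ⟿ w →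
    w ≢ x₀ → w ≢ x₁ → u₀ ≢ y₀ → u₁ ≢ y₀ → u₀ ≢ u₁ → x₁ ⟶ u₁ → Cover I
  viaFirst p {w} {u₀} {u₁} x₀y₀ y₀w w≢x₀ w≢x₁ u₀≢ u₁≢ u₀≢u₁ x₁u₁ =
    _ , cycle x₀ y₀ w u₀ ((x₁ , u₁) ∷ []) refl
    (x₀y₀ , y₀w , fromBig (bigY u₀≢) w≢x₀ w≢x₁ , toAll (bigY u₀≢) , x₁u₁ , toAll (bigY u₁≢))
    (unique₃ (≢-sym w≢x₀) x₀≢x₁ w≢x₁) (unique₃ (≢-sym u₀≢) (≢-sym u₁≢) u₀≢u₁)
    (covered (here refl) (there (there (here refl)))) (rem⁺ I bigY (here refl))
    where open SmallPair p

  -- The 6-cycle x₀ u₀ x₁ u₁ w y₀, for a `y₀` whose out-neighbours all lie in the small pair.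
  backToFirst : (p : SmallPair I) → let open SmallPair p in ∀ {w u₀ u₁} → y₀ ⟿ x₀ → w ⟶ y₀ →
    w ≢ x₀ → w ≢ x₁ → u₀ ≢ y₀ → u₁ ≢ y₀ → x₀ ⟶ u₀ → x₁ ⟶ u₁ → Cover I
  backToFirst p {w} {u₀} {u₁} y₀x₀ wy₀ w≢x₀ w≢x₁ u₀≢ u₁≢ x₀u₀ x₁u₁ =
    _ , cycle x₀ u₀ x₁ u₁ ((w , y₀) ∷ []) refl
    (x₀u₀ , toAll (bigY u₀≢) , x₁u₁ , toAll (bigY u₁≢) , wy₀ , y₀x₀)
    (unique₃ x₀≢x₁ (≢-sym w≢x₀) (≢-sym w≢x₁)) (unique₃ (disjoint≢ x₀u₀ x₁u₁) u₀≢ u₁≢)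
    (covered (here refl) (there (here refl))) (rem⁺ I bigY (there (there (here refl))))
    where open SmallPair p

  -- Now `x₁ → y₀` is forced, and every big vertex of Y has its missing arc at `x₁`, so it is
  -- reached from `x₀`. The cycle leaves x₁ → y₀ along the arc from `escape`, which may or may not
  -- end in `x₀`.
  pinned : (p : SmallPair I) → let open SmallPair p in (∀ {y} → y ≢ y₀ → ¬ x₁ ⟶ y) → Cover I
  pinned p none with fresh (y₀ ∷ []) (ℕ.≤-trans (s≤s (s≤s z≤n)) 4≤a)
  ... | u , u∉ with fresh (y₀ ∷ u ∷ []) (ℕ.≤-trans (s≤s (s≤s (s≤s z≤n))) 4≤a)
                  | fresh (SmallPair.x₀ p ∷ SmallPair.x₁ p ∷ []) (ℕ.≤-trans (s≤s (s≤s (s≤s z≤n))) 4≤a)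
  ... | u' , u'∉ | w , w∉ = go (escape x₁ y₀)
    where
    open SmallPair p
    u≢ : u ≢ y₀
    u≢ e = u∉ (here e)
    u'≢ : u' ≢ y₀
    u'≢ e = u'∉ (here e)
    u'≢u : u' ≢ u
    u'≢u e = u'∉ (there (here e))
    w≢x₀ : w ≢ x₀
    w≢x₀ e = w∉ (here e)
    w≢x₁ : w ≢ x₁
    w≢x₁ e = w∉ (there (here e))
    x₁y₀ : x₁ ⟶ y₀
    x₁y₀ with outX x₁
    ... | y , q with y ≟ y₀
    ... | yes refl = q
    ... | no ne = contradiction q (none ne)
    go : (∃ λ x' → x' ≢ x₁ × y₀ ⟿ x') ⊎ (∃ λ y' → y' ≢ y₀ × x₁ ⟶ y') → Cover I
    go (inj₂ (y' , ne , q)) = contradiction q (none ne)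
    go (inj₁ (x' , ne , q)) with x' ≟ x₀
    ... | yes refl = _ , cycle x₁ y₀ x₀ u' ((w , u) ∷ []) refl
          (x₁y₀ , q , fromOther (bigY u'≢) (none u'≢) , toAll (bigY u'≢) ,
           fromBig (bigY u≢) w≢x₀ w≢x₁ , toAll (bigY u≢))
          (unique₃ (≢-sym x₀≢x₁) (≢-sym w≢x₁) (≢-sym w≢x₀)) (unique₃ (≢-sym u'≢) (≢-sym u≢) u'≢u)
          (covered (there (here refl)) (here refl)) (rem⁺ I bigY (here refl))
    ... | no x'≢x₀ = _ , cycle x₁ y₀ x' u' ((x₀ , u) ∷ []) refl
          (x₁y₀ , q , fromBig (bigY u'≢) x'≢x₀ ne , toAll (bigY u'≢) ,
           fromOther (bigY u≢) (none u≢) , toAll (bigY u≢))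
          (unique₃ (≢-sym ne) (≢-sym x₀≢x₁) x'≢x₀) (unique₃ (≢-sym u'≢) (≢-sym u≢) u'≢u)
          (covered (there (there (here refl))) (here refl)) (rem⁺ I bigY (here refl))

  module _ (p : SmallPair I) where
    open SmallPair p

    avoiding : List (Fin a)
    avoiding = x₀ ∷ x₁ ∷ []

    3≤a : 3 ≤ a
    3≤a = ℕ.≤-trans (s≤s (s≤s (s≤s z≤n))) 4≤a

    -- Big vertices of Y reach all of X, so x₀ u₀ x₁ u₁ is already a path that can go on anywhere;
    -- it remains to visit `y₀`. With big neighbours in both directions, `spread` in the dual gives
    -- v' → y₀ → v and an 8-cycle. Otherwise every big vertex of X has its missing arc at `y₀`, so
    -- the opposite arc is present, and `y₀` is joined to the small pair in the missing direction.
    free : ∀ {u₀ u₁} → u₀ ≢ y₀ → x₀ ⟶ u₀ → u₁ ≢ y₀ → x₁ ⟶ u₁ → Cover I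
    free {u₀} {u₁} u₀≢ x₀u₀ u₁≢ x₁u₁ with any? (λ w → ¬? (w ∈? avoiding) ×-dec T? (Q y₀ w))
      | any? (λ w → ¬? (w ∈? avoiding) ×-dec T? (P w y₀))
    ... | yes (w , w∉ , y₀w) | yes (w' , w'∉ , w'y₀)
      with spread (dual I) avoiding 4≤a (covered (here refl) (there (here refl))) w∉ y₀w w'∉ w'y₀
         | fresh (y₀ ∷ u₀ ∷ u₁ ∷ []) 4≤a
    ...   | v , v' , v∉ , v'∉ , v≢v' , y₀v , v'y₀ | u₂ , u₂∉ =
            _ , cycle x₀ u₀ x₁ u₁ ((v' , y₀) ∷ (v , u₂) ∷ []) refl
            (x₀u₀ , toAll (bigY u₀≢) , x₁u₁ , toAll (bigY u₁≢) , v'y₀ , y₀v ,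
             fromBig (bigY u₂≢) (λ e → v∉ (here e)) (λ e → v∉ (there (here e))) , toAll (bigY u₂≢))
            (unique₄ x₀≢x₁ (λ e → v'∉ (here (sym e))) (λ e → v∉ (here (sym e)))
              (λ e → v'∉ (there (here (sym e)))) (λ e → v∉ (there (here (sym e)))) (≢-sym v≢v'))
            (unique₄ (disjoint≢ x₀u₀ x₁u₁) u₀≢ (λ e → u₂∉ (there (here (sym e)))) u₁≢
              (λ e → u₂∉ (there (there (here (sym e))))) (≢-sym u₂≢))
            (covered (here refl) (there (here refl))) (rem⁺ I bigY (there (there (here refl))))
            where
            u₂≢ : u₂ ≢ y₀
            u₂≢ e = u₂∉ (here e)
    free {u₀} {u₁} u₀≢ x₀u₀ u₁≢ x₁u₁ | no ¬out | _ with fresh avoiding 3≤a | outY y₀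
    ...   | w , w∉ | x , y₀x = go
      where
      w≢x₀ : w ≢ x₀
      w≢x₀ e = w∉ (here e)
      w≢x₁ : w ≢ x₁
      w≢x₁ e = w∉ (there (here e))
      wy₀ : w ⟶ y₀
      wy₀ = in-out (satX (others w≢x₀ w≢x₁)) (λ q → ¬out (w , w∉ , q))
      go : Cover I
      go with x ∈? avoiding
      ... | no x∉ = contradiction (x , x∉ , y₀x) ¬out
      ... | yes (here refl) = backToFirst p y₀x wy₀ w≢x₀ w≢x₁ u₀≢ u₁≢ x₀u₀ x₁u₁
      ... | yes (there (here refl)) = backToFirst (exchange p) y₀x wy₀ w≢x₁ w≢x₀ u₁≢ u₀≢ x₁u₁ x₀u₀
    free {u₀} {u₁} u₀≢ x₀u₀ u₁≢ x₁u₁ | yes _ | no ¬in with fresh avoiding 3≤a | inY y₀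
    ...   | w , w∉ | x , xy₀ = go
      where
      w≢x₀ : w ≢ x₀
      w≢x₀ e = w∉ (here e)
      w≢x₁ : w ≢ x₁
      w≢x₁ e = w∉ (there (here e))
      y₀w : y₀ ⟿ w
      y₀w = out-in (satX (others w≢x₀ w≢x₁)) (λ q → ¬in (w , w∉ , q))
      u₀≢u₁ : u₀ ≢ u₁
      u₀≢u₁ = disjoint≢ x₀u₀ x₁u₁
      go : Cover I
      go with x ∈? avoiding
      ... | no x∉ = contradiction (x , x∉ , xy₀) ¬in
      ... | yes (here refl) = viaFirst p xy₀ y₀w w≢x₀ w≢x₁ u₀≢ u₁≢ u₀≢u₁ x₁u₁
      ... | yes (there (here refl)) = viaFirst (exchange p) xy₀ y₀w w≢x₁ w≢x₀ u₁≢ u₀≢ (≢-sym u₀≢u₁) x₀u₀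

    cover : Cover I
    cover with any? (λ y → ¬? (y ≟ y₀) ×-dec T? (P x₀ y)) | any? (λ y → ¬? (y ≟ y₀) ×-dec T? (P x₁ y))
    ... | yes (u₀ , u₀≢ , x₀u₀) | yes (u₁ , u₁≢ , x₁u₁) = free u₀≢ x₀u₀ u₁≢ x₁u₁
    ... | _ | no ¬p = pinned p (λ ne q → ¬p (_ , ne , q))
    ... | no ¬p | yes _ = pinned (exchange p) (λ ne q → ¬p (_ , ne , q))

-- Two small vertices on each side.

module TwoTwo {a} (I : Config a) (p : SmallPair I) (q : SmallPair (dual I)) where
  open Config I
  open SmallPair p
  open SmallPair q using () renaming
    ( x₀ to y₀ ; x₁ to y₁ ; x₀≢x₁ to y₀≢y₁ ; others to othersY ; disjoint to disjointY
    ; disjoint≢ to disjointY≢ ; covered to coveredY ; toAll to toAllY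
    ; fromOther to fromOtherY
    ; w₀ to u₀ ; w₁ to u₁ ; w₀≢x₀ to u₀≢y₀ ; w₀≢x₁ to u₀≢y₁
    ; w₁≢x₀ to u₁≢y₀ ; w₁≢x₁ to u₁≢y₁ ; w₁≢w₀ to u₁≢u₀ )

  bu₀ : BY u₀
  bu₀ = othersY u₀≢y₀ u₀≢y₁

  bu₁ : BY u₁
  bu₁ = othersY u₁≢y₀ u₁≢y₁

  bw₀ : BX w₀
  bw₀ = others w₀≢x₀ w₀≢x₁

  bw₁ : BX w₁
  bw₁ = others w₁≢x₀ w₁≢x₁

  -- The 8-cycle x₁ z x₀ y₀ v y₁ v' t with `t` fresh and big. The vertices `v` and `v'` differ
  -- because small `y₀` and `y₁` share no out-neighbour.
  smallArc : ∀ {v v' z} → x₀ ⟶ y₀ → v ≢ x₀ → v ≢ x₁ → y₀ ⟿ v → v' ≢ x₀ → v' ≢ x₁ → y₁ ⟿ v' →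
    z ≢ y₀ → z ≢ y₁ → x₁ ⟶ z → Cover I
  smallArc {v} {v'} {z} x₀y₀ v≢x₀ v≢x₁ y₀v v'≢x₀ v'≢x₁ y₁v' z≢y₀ z≢y₁ x₁z
    with fresh (y₀ ∷ y₁ ∷ z ∷ []) 4≤a
  ... | t , t∉ = _ , cycle x₁ z x₀ y₀ ((v , y₁) ∷ (v' , t) ∷ []) refl
    (x₁z , toAll (othersY z≢y₀ z≢y₁) , x₀y₀ , y₀v , toAllY (others v≢x₀ v≢x₁) , y₁v' ,
     fromBig bt v'≢x₀ v'≢x₁ , toAll bt)
    (unique₄ (≢-sym x₀≢x₁) (≢-sym v≢x₁) (≢-sym v'≢x₁) (≢-sym v≢x₀) (≢-sym v'≢x₀) (disjointY≢ y₀v y₁v'))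
    (unique₄ z≢y₀ z≢y₁ (λ e → t∉ (there (there (here (sym e))))) y₀≢y₁ (λ e → t∉ (here (sym e)))
      (λ e → t∉ (there (here (sym e)))))
    (covered (there (here refl)) (here refl)) (coveredY (there (here refl)) (there (there (here refl))))
    where
    bt : BY t
    bt = othersY (λ e → t∉ (here e)) (λ e → t∉ (there (here e)))

  -- Since `x₁` and `y₁` miss all big vertices opposite, `x₀` and `y₀` reach all of them. The
  -- out-neighbour of `y₁` is therefore small: `x₀` gives a 6-cycle, `x₁` an 8-cycle.
  trapped₁ : (∀ {y} → y ≢ y₀ → y ≢ y₁ → ¬ x₁ ⟶ y) → x₁ ⟶ y₀ →
    (∀ {x} → x ≢ x₀ → x ≢ x₁ → ¬ y₁ ⟿ x) → Cover I
  trapped₁ none x₁y₀ noneY with outY y₁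
  ... | x , y₁x with x ≟ x₀ | x ≟ x₁
  ... | no ne | no ne' = contradiction y₁x (noneY ne ne')
  ... | yes refl | _ = _ , cycle x₁ y₀ w₀ y₁ ((x₀ , u₀) ∷ []) refl
        (x₁y₀ , fromOtherY bw₀ (noneY w₀≢x₀ w₀≢x₁) , toAllY bw₀ , y₁x ,
         fromOther bu₀ (none u₀≢y₀ u₀≢y₁) , toAll bu₀)
        (unique₃ (≢-sym w₀≢x₁) (≢-sym x₀≢x₁) w₀≢x₀) (unique₃ y₀≢y₁ (≢-sym u₀≢y₀) (≢-sym u₀≢y₁))
        (covered (there (there (here refl))) (here refl)) (coveredY (here refl) (there (here refl)))
  ... | no _ | yes refl = _ , cycle w₀ y₁ x₁ y₀ ((w₁ , u₀) ∷ (x₀ , u₁) ∷ []) refl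
        (toAllY bw₀ , y₁x , x₁y₀ , fromOtherY bw₁ (noneY w₁≢x₀ w₁≢x₁) , fromBig bu₀ w₁≢x₀ w₁≢x₁ ,
         toAll bu₀ , fromOther bu₁ (none u₁≢y₀ u₁≢y₁) , toAll bu₁)
        (unique₄ w₀≢x₁ (≢-sym w₁≢w₀) w₀≢x₀ (≢-sym w₁≢x₁) (≢-sym x₀≢x₁) w₁≢x₀)
        (unique₄ (≢-sym y₀≢y₁) (≢-sym u₀≢y₁) (≢-sym u₁≢y₁) (≢-sym u₀≢y₀) (≢-sym u₁≢y₀) (≢-sym u₁≢u₀))
        (covered (there (there (there (here refl)))) (there (here refl)))
        (coveredY (there (here refl)) (here refl))

  -- Here `x₀` and `y₁` are the small vertices that reach all big ones opposite, and x₁ → y₀ → x₀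
  -- extends to the 8-cycle x₁ y₀ x₀ u₁ w₀ y₁ w₁ u₀.
  trapped₀ : (∀ {y} → y ≢ y₀ → y ≢ y₁ → ¬ x₁ ⟶ y) → x₁ ⟶ y₀ → y₀ ⟿ x₀ →
    (∀ {x} → x ≢ x₀ → x ≢ x₁ → ¬ y₀ ⟿ x) → Cover I
  trapped₀ none x₁y₀ y₀x₀ noneY = _ , cycle x₁ y₀ x₀ u₁ ((w₀ , y₁) ∷ (w₁ , u₀) ∷ []) refl
    (x₁y₀ , y₀x₀ , fromOther bu₁ (none u₁≢y₀ u₁≢y₁) , toAll bu₁ , toAllY bw₀ ,
     SmallPair.fromOther (exchange q) bw₁ (noneY w₁≢x₀ w₁≢x₁) , fromBig bu₀ w₁≢x₀ w₁≢x₁ , toAll bu₀)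
    (unique₄ (≢-sym x₀≢x₁) (≢-sym w₀≢x₁) (≢-sym w₁≢x₁) (≢-sym w₀≢x₀) (≢-sym w₁≢x₀) (≢-sym w₁≢w₀))
    (unique₄ (≢-sym u₁≢y₀) y₀≢y₁ (≢-sym u₀≢y₀) u₁≢y₁ u₁≢u₀ (≢-sym u₀≢y₁))
    (covered (there (here refl)) (here refl)) (coveredY (here refl) (there (there (here refl))))

  bigHeadX : Dec (∃ λ y → y ≢ y₀ × y ≢ y₁ × x₁ ⟶ y)
  bigHeadX = any? λ y → ¬? (y ≟ y₀) ×-dec ¬? (y ≟ y₁) ×-dec T? (P x₁ y)

  bigHeadY : Dec (∃ λ x → x ≢ x₀ × x ≢ x₁ × y₀ ⟿ x)
  bigHeadY = any? λ x → ¬? (x ≟ x₀) ×-dec ¬? (x ≟ x₁) ×-dec T? (Q y₀ x)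

  module _ {z₀ z₁ v₀ v₁ : Fin a}
    (z₀≢y₀ : z₀ ≢ y₀) (z₀≢y₁ : z₀ ≢ y₁) (x₀z₀ : x₀ ⟶ z₀)
    (z₁≢y₀ : z₁ ≢ y₀) (z₁≢y₁ : z₁ ≢ y₁) (x₁z₁ : x₁ ⟶ z₁)
    (v₀≢x₀ : v₀ ≢ x₀) (v₀≢x₁ : v₀ ≢ x₁) (y₀v₀ : y₀ ⟿ v₀)
    (v₁≢x₀ : v₁ ≢ x₀) (v₁≢x₁ : v₁ ≢ x₁) (y₁v₁ : y₁ ⟿ v₁) where

    z₀≢z₁ : z₀ ≢ z₁
    z₀≢z₁ = disjoint≢ x₀z₀ x₁z₁

    v₀≢v₁ : v₀ ≢ v₁
    v₀≢v₁ = disjointY≢ y₀v₀ y₁v₁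

    bz₀ : BY z₀
    bz₀ = othersY z₀≢y₀ z₀≢y₁

    bz₁ : BY z₁
    bz₁ = othersY z₁≢y₀ z₁≢y₁

    bv₀ : BX v₀
    bv₀ = others v₀≢x₀ v₀≢x₁

    bv₁ : BX v₁
    bv₁ = others v₁≢x₀ v₁≢x₁

    -- The cycle is x₀ z₀ x₁ z₁ v y₀ v₀ y₁ v₁ z, where `v` and `z` are fifth vertices of their
    -- sides.
    tenCycle : 4 < a → Cover I
    tenCycle 4<a with fresh (x₀ ∷ x₁ ∷ v₀ ∷ v₁ ∷ []) 4<a | fresh (y₀ ∷ y₁ ∷ z₀ ∷ z₁ ∷ []) 4<a
    ... | v , v∉ | z , z∉ = _ , cycle x₀ z₀ x₁ z₁ ((v , y₀) ∷ (v₀ , y₁) ∷ (v₁ , z) ∷ []) refl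
      (x₀z₀ , toAll bz₀ , x₁z₁ , toAll bz₁ , toAllY (others v≢x₀ v≢x₁) , y₀v₀ , toAllY bv₀ , y₁v₁ ,
       fromBig bz v₁≢x₀ v₁≢x₁ , toAll bz)
      (unique₅ x₀≢x₁ (≢-sym v≢x₀) (≢-sym v₀≢x₀) (≢-sym v₁≢x₀) (≢-sym v≢x₁) (≢-sym v₀≢x₁) (≢-sym v₁≢x₁)
        (λ e → v∉ (there (there (here e)))) (λ e → v∉ (there (there (there (here e))))) v₀≢v₁)
      (unique₅ z₀≢z₁ z₀≢y₀ z₀≢y₁ (λ e → z∉ (there (there (here (sym e))))) z₁≢y₀ z₁≢y₁
        (λ e → z∉ (there (there (there (here (sym e)))))) y₀≢y₁
        (λ e → z∉ (here (sym e))) (λ e → z∉ (there (here (sym e)))))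
      (covered (here refl) (there (here refl)))
      (coveredY (there (there (here refl))) (there (there (there (here refl)))))
      where
      v≢x₀ : v ≢ x₀
      v≢x₀ e = v∉ (here e)
      v≢x₁ : v ≢ x₁
      v≢x₁ e = v∉ (there (here e))
      bz : BY z
      bz = othersY (λ e → z∉ (here e)) (λ e → z∉ (there (here e)))

    -- All 32 possible arcs are determined: big vertices reach everything opposite, arcs between
    -- small ones are absent, and disjointness settles the arcs from small to big.
    d8 : 4 ≡ a → ¬ x₀ ⟶ y₀ → ¬ x₀ ⟶ y₁ → ¬ x₁ ⟶ y₀ → ¬ x₁ ⟶ y₁ →
      ¬ y₀ ⟿ x₀ → ¬ y₀ ⟿ x₁ → ¬ y₁ ⟿ x₀ → ¬ y₁ ⟿ x₁ → D8Labelling I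
    d8 e n₀₀ n₀₁ n₁₀ n₁₁ m₀₀ m₀₁ m₁₀ m₁₁ =
      enumerate (unique₄ x₀≢x₁ (≢-sym v₀≢x₀) (≢-sym v₁≢x₀) (≢-sym v₀≢x₁) (≢-sym v₁≢x₁) v₀≢v₁) e ,
      -- The small vertices of `D8` are its x₀, x₁, y₂ and y₃, so the big `z₀` and `z₁` come first
      -- on this side.
      enumerate (unique₄ z₀≢z₁ z₀≢y₀ z₀≢y₁ z₁≢y₀ z₁≢y₁ y₀≢y₁) e ,
      xy-arcs , yx-arcs
      where
      toX : Fin 4 → Fin a
      toX = lookup (x₀ ∷ x₁ ∷ v₀ ∷ v₁ ∷ [])
      toY : Fin 4 → Fin a
      toY = lookup (z₀ ∷ z₁ ∷ y₀ ∷ y₁ ∷ [])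
      xy-arcs : ∀ i j → P (toX i) (toY j) ≡ D8xy i j
      xy-arcs zero zero = T⇒≡true x₀z₀
      xy-arcs zero (suc zero) = ¬T⇒≡false (λ t → disjoint t x₁z₁)
      xy-arcs zero (suc (suc zero)) = ¬T⇒≡false n₀₀
      xy-arcs zero (suc (suc (suc zero))) = ¬T⇒≡false n₀₁
      xy-arcs (suc zero) zero = ¬T⇒≡false (disjoint x₀z₀)
      xy-arcs (suc zero) (suc zero) = T⇒≡true x₁z₁
      xy-arcs (suc zero) (suc (suc zero)) = ¬T⇒≡false n₁₀
      xy-arcs (suc zero) (suc (suc (suc zero))) = ¬T⇒≡false n₁₁
      xy-arcs (suc (suc zero)) zero = T⇒≡true (fromBig bz₀ v₀≢x₀ v₀≢x₁)
      xy-arcs (suc (suc zero)) (suc zero) = T⇒≡true (fromBig bz₁ v₀≢x₀ v₀≢x₁)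
      xy-arcs (suc (suc zero)) (suc (suc zero)) = T⇒≡true (toAllY bv₀)
      xy-arcs (suc (suc zero)) (suc (suc (suc zero))) = T⇒≡true (toAllY bv₀)
      xy-arcs (suc (suc (suc zero))) zero = T⇒≡true (fromBig bz₀ v₁≢x₀ v₁≢x₁)
      xy-arcs (suc (suc (suc zero))) (suc zero) = T⇒≡true (fromBig bz₁ v₁≢x₀ v₁≢x₁)
      xy-arcs (suc (suc (suc zero))) (suc (suc zero)) = T⇒≡true (toAllY bv₁)
      xy-arcs (suc (suc (suc zero))) (suc (suc (suc zero))) = T⇒≡true (toAllY bv₁)
      yx-arcs : ∀ j i → Q (toY j) (toX i) ≡ D8yx j i
      yx-arcs zero zero = T⇒≡true (toAll bz₀)
      yx-arcs zero (suc zero) = T⇒≡true (toAll bz₀)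
      yx-arcs zero (suc (suc zero)) = T⇒≡true (toAll bz₀)
      yx-arcs zero (suc (suc (suc zero))) = T⇒≡true (toAll bz₀)
      yx-arcs (suc zero) zero = T⇒≡true (toAll bz₁)
      yx-arcs (suc zero) (suc zero) = T⇒≡true (toAll bz₁)
      yx-arcs (suc zero) (suc (suc zero)) = T⇒≡true (toAll bz₁)
      yx-arcs (suc zero) (suc (suc (suc zero))) = T⇒≡true (toAll bz₁)
      yx-arcs (suc (suc zero)) zero = ¬T⇒≡false m₀₀
      yx-arcs (suc (suc zero)) (suc zero) = ¬T⇒≡false m₀₁
      yx-arcs (suc (suc zero)) (suc (suc zero)) = T⇒≡true y₀v₀
      yx-arcs (suc (suc zero)) (suc (suc (suc zero))) = ¬T⇒≡false (λ t → disjointY t y₁v₁)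
      yx-arcs (suc (suc (suc zero))) zero = ¬T⇒≡false m₁₀
      yx-arcs (suc (suc (suc zero))) (suc zero) = ¬T⇒≡false m₁₁
      yx-arcs (suc (suc (suc zero))) (suc (suc zero)) = ¬T⇒≡false (disjointY y₀v₀)
      yx-arcs (suc (suc (suc zero))) (suc (suc (suc zero))) = T⇒≡true y₁v₁

module _ {a} (I : Config a) (p : SmallPair I) (q : SmallPair (dual I)) where
  open Config I
  open SmallPair p using (x₀; x₁; fromOther)
  open SmallPair q using () renaming (x₀ to y₀; x₁ to y₁)
  open TwoTwo I p q

  private
    p' = exchange p
    q' = exchange q

  -- If `y₀` and `y₁` both have big out-neighbours, `smallArc` runs along `x₁ → y₀`, as `x₀` reaches
  -- every big vertex of Y. If `y₁` has none, `trapped₁` applies. If only `y₀` has none, the arc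
  -- leaving `x₁` and `y₀` ends in `x₀` or `y₁`, which is `trapped₀` or an exchanged `trapped₁`.
  trappedAt : (∀ {y} → y ≢ y₀ → y ≢ y₁ → ¬ x₁ ⟶ y) → x₁ ⟶ y₀ → Cover I
  trappedAt none x₁y₀ with bigHeadY | TwoTwo.bigHeadY I p q'
  ... | yes (v , v≢x₀ , v≢x₁ , y₀v) | yes (v' , v'≢x₀ , v'≢x₁ , y₁v') =
        TwoTwo.smallArc I p' q x₁y₀ v≢x₁ v≢x₀ y₀v v'≢x₁ v'≢x₀ y₁v'
          (SmallPair.w₀≢x₀ q) (SmallPair.w₀≢x₁ q)
          (fromOther bu₀ (none (SmallPair.w₀≢x₀ q) (SmallPair.w₀≢x₁ q)))
  ... | _ | no ¬y₁ = trapped₁ none x₁y₀ λ m n t → ¬y₁ (_ , m , n , t)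
  ... | no ¬y₀ | yes _ = go (escape x₁ y₀)
    where
    noneY : ∀ {x} → x ≢ x₀ → x ≢ x₁ → ¬ y₀ ⟿ x
    noneY m n t = ¬y₀ (_ , m , n , t)
    go : (∃ λ x' → x' ≢ x₁ × y₀ ⟿ x') ⊎ (∃ λ y' → y' ≢ y₀ × x₁ ⟶ y') → Cover I
    go (inj₁ (x' , ne , t)) with x' ≟ x₀
    ... | yes refl = trapped₀ none x₁y₀ t noneY
    ... | no ne' = contradiction t (noneY ne' ne)
    go (inj₂ (y' , ne , t)) with y' ≟ y₁
    ... | yes refl = TwoTwo.trapped₁ I p q' (λ m n → none n m) t noneY
    ... | no ne' = contradiction t (none ne ne')

trapped : ∀ {a} (I : Config a) (p : SmallPair I) (q : SmallPair (dual I)) → let open Config I in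
  (∀ {y} → y ≢ SmallPair.x₀ q → y ≢ SmallPair.x₁ q → ¬ SmallPair.x₁ p ⟶ y) → Cover I
trapped I p q none with Config.outX I (SmallPair.x₁ p)
... | y , t with y ≟ SmallPair.x₀ q | y ≟ SmallPair.x₁ q
... | yes refl | _ = trappedAt I p q none t
... | no _ | yes refl = trappedAt I p (exchange q) (λ m n → none n m) t
... | no m | no n = contradiction t (none m n)

-- A small vertex without big out-neighbour is trapped. If there is none, any arc between small
-- vertices gives a cycle by `smallArc`; with no such arc either, `a > 4` gives the 10-cycle and
-- `a = 4` gives D(8).
twoTwo : ∀ {a} (I : Config a) → SmallPair I → SmallPair (dual I) → ¬ D8Labelling I →
  Cover I ⊎ Cover (dual I)
twoTwo {a} I p q ¬d8 with TwoTwo.bigHeadX I (exchange p) q | TwoTwo.bigHeadX I p q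
  | TwoTwo.bigHeadY I p q | TwoTwo.bigHeadY I p (exchange q)
... | no ¬t | _ | _ | _ = inj₁ (trapped I (exchange p) q λ m n t → ¬t (_ , m , n , t))
... | yes _ | no ¬t | _ | _ = inj₁ (trapped I p q λ m n t → ¬t (_ , m , n , t))
... | yes _ | yes _ | no ¬t | _ =
      inj₂ (trapped (dual I) (exchange q) (undual p) λ m n t → ¬t (_ , m , n , t))
... | yes _ | yes _ | yes _ | no ¬t =
      inj₂ (trapped (dual I) q (undual p) λ m n t → ¬t (_ , m , n , t))
... | yes (z₀ , z₀≢y₀ , z₀≢y₁ , x₀z₀) | yes (z₁ , z₁≢y₀ , z₁≢y₁ , x₁z₁)
    | yes (v₀ , v₀≢x₀ , v₀≢x₁ , y₀v₀) | yes (v₁ , v₁≢x₀ , v₁≢x₁ , y₁v₁) = go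
  where
  open Config I
  open SmallPair p using (x₀; x₁)
  open SmallPair q using () renaming (x₀ to y₀; x₁ to y₁)
  p' = exchange p
  q' = exchange q
  module S = TwoTwo I
  module Sᵈ = TwoTwo (dual I)

  go : Cover I ⊎ Cover (dual I)
  go with T? (P x₀ y₀) | T? (P x₀ y₁) | T? (P x₁ y₀) | T? (P x₁ y₁)
  ... | yes t | _ | _ | _ = inj₁ (S.smallArc p q t v₀≢x₀ v₀≢x₁ y₀v₀ v₁≢x₀ v₁≢x₁ y₁v₁ z₁≢y₀ z₁≢y₁ x₁z₁)
  ... | _ | yes t | _ | _ = inj₁ (S.smallArc p q' t v₁≢x₀ v₁≢x₁ y₁v₁ v₀≢x₀ v₀≢x₁ y₀v₀ z₁≢y₁ z₁≢y₀ x₁z₁)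
  ... | _ | _ | yes t | _ = inj₁ (S.smallArc p' q t v₀≢x₁ v₀≢x₀ y₀v₀ v₁≢x₁ v₁≢x₀ y₁v₁ z₀≢y₀ z₀≢y₁ x₀z₀)
  ... | _ | _ | _ | yes t = inj₁ (S.smallArc p' q' t v₁≢x₁ v₁≢x₀ y₁v₁ v₀≢x₁ v₀≢x₀ y₀v₀ z₀≢y₁ z₀≢y₀ x₀z₀)
  ... | no n₀₀ | no n₀₁ | no n₁₀ | no n₁₁
    with T? (Q y₀ x₀) | T? (Q y₀ x₁) | T? (Q y₁ x₀) | T? (Q y₁ x₁)
  ...   | yes t | _ | _ | _ =
          inj₂ (Sᵈ.smallArc q (undual p) t z₀≢y₀ z₀≢y₁ x₀z₀ z₁≢y₀ z₁≢y₁ x₁z₁ v₁≢x₀ v₁≢x₁ y₁v₁)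
  ...   | _ | yes t | _ | _ =
          inj₂ (Sᵈ.smallArc q (undual p') t z₁≢y₀ z₁≢y₁ x₁z₁ z₀≢y₀ z₀≢y₁ x₀z₀ v₁≢x₁ v₁≢x₀ y₁v₁)
  ...   | _ | _ | yes t | _ =
          inj₂ (Sᵈ.smallArc q' (undual p) t z₀≢y₁ z₀≢y₀ x₀z₀ z₁≢y₁ z₁≢y₀ x₁z₁ v₀≢x₀ v₀≢x₁ y₀v₀)
  ...   | _ | _ | _ | yes t =
          inj₂ (Sᵈ.smallArc q' (undual p') t z₁≢y₁ z₁≢y₀ x₁z₁ z₀≢y₁ z₀≢y₀ x₀z₀ v₀≢x₁ v₀≢x₀ y₀v₀)
  ...   | no m₀₀ | no m₀₁ | no m₁₀ | no m₁₁ with 4 <? a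
  ...     | yes 4<a = inj₁ (S.tenCycle p q z₀≢y₀ z₀≢y₁ x₀z₀ z₁≢y₀ z₁≢y₁ x₁z₁
                        v₀≢x₀ v₀≢x₁ y₀v₀ v₁≢x₀ v₁≢x₁ y₁v₁ 4<a)
  ...     | no 4≮a = contradiction
            (S.d8 p q z₀≢y₀ z₀≢y₁ x₀z₀ z₁≢y₀ z₁≢y₁ x₁z₁ v₀≢x₀ v₀≢x₁ y₀v₀ v₁≢x₀ v₁≢x₁ y₁v₁
              (ℕ.≤-antisym 4≤a (ℕ.≮⇒≥ 4≮a)) n₀₀ n₀₁ n₁₀ n₁₁ m₀₀ m₀₁ m₁₀ m₁₁) ¬d8

-- Among three small vertices of X, at least two would have an arc into the big `y`, contradicting
-- disjointness of their out-neighbourhoods.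
classify : ∀ {a} (I : Config a) → let open Config I in
  ∃ BY → (∃ λ x₀ → ∀ {x} → x ≢ x₀ → BX x) ⊎ SmallPair I
classify I (y , by) with any? (λ x → ¬? (Config.BX? I x))
-- With no small vertex, any vertex may serve as the exceptional one; an in-neighbour of `y` is at
-- hand.
... | no ¬s = inj₁ (proj₁ (inY y) , λ {x} _ → decidable-stable (BX? x) λ b → ¬s (x , b))
  where open Config I
... | yes (x₀ , s₀) with any? (λ x → ¬? (x ≟ x₀) ×-dec ¬? (Config.BX? I x))
...   | no ¬s = inj₁ (x₀ , λ {x} ne → decidable-stable (Config.BX? I x) λ b → ¬s (x , ne , b))
...   | yes (x₁ , ne , s₁) = inj₂ record
        { x₀ = x₀ ; x₁ = x₁ ; x₀≢x₁ = ≢-sym ne ; small₀ = s₀ ; small₁ = s₁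
        ; others = λ {x} m n → decidable-stable (BX? x) (third m n) }
  where
  open Config I
  apart : ∀ {u v} → u ≢ v → ¬ BX u → ¬ BX v → u ⟶ y → ¬ v ⟶ y
  apart u≢v su sv t t' = [ su , sv ]′ (domX u≢v t t')
  third : ∀ {x} → x ≢ x₀ → x ≢ x₁ → ¬ ¬ BX x
  third {x} m n s with T? (P x₀ y) | T? (P x₁ y)
  ... | yes t | _ = apart (≢-sym m) s₀ s t (in-in (satY by) (apart (≢-sym ne) s₀ s₁ t) n)
  ... | no ¬t | yes t' = apart (≢-sym n) s₁ s t' (in-in (satY by) ¬t m)
  ... | no ¬t | no ¬t' = ¬t' (in-in (satY by) ¬t ne)

coverOrDual : ∀ {a} (I : Config a) → let open Config I in
  ∃ BX → ∃ BY → ¬ D8Labelling I → Cover I ⊎ Cover (dual I)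
coverOrDual I bx by ¬d8 with classify I by | classify (dual I) bx
... | inj₂ p | inj₂ q = twoTwo I p q ¬d8
... | inj₂ p | inj₁ (y₀ , bigY) = inj₁ (TwoOne.cover I bigY p)
... | inj₁ (x₀ , bigX) | inj₂ q = inj₂ (TwoOne.cover (dual I) bigX q)
... | inj₁ (x₀ , bigX) | inj₁ (y₀ , bigY)
  with OneOne.through I bigX bigY | OneOne.through (dual I) bigY bigX
...   | inj₁ c | _ = inj₁ c
...   | inj₂ _ | inj₁ c = inj₂ c
...   | inj₂ t | inj₂ t' = inj₁ (OneOne.link I bigX bigY t t')

-- Degree counts and missing arcs.

count≤ : ∀ {A : Set} (p : A → Bool) l → countTrue p l ≤ length l
count≤ p [] = z≤n
count≤ p (x ∷ l) with p x
... | true = s≤s (count≤ p l)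
... | false = ℕ.m≤n⇒m≤1+n (count≤ p l)

count-miss : ∀ {A : Set} (p : A → Bool) {l z} → z ∈ l → ¬ T (p z) → suc (countTrue p l) ≤ length l
count-miss p {x ∷ l} (here refl) ¬t with p x
... | true = contradiction _ ¬t
... | false = s≤s (count≤ p l)
count-miss p {x ∷ l} (there m) ¬t with p x
... | true = s≤s (count-miss p m ¬t)
... | false = ℕ.m≤n⇒m≤1+n (count-miss p m ¬t)

count-miss₂ : ∀ {A : Set} (p : A → Bool) {l z z'} → z ≢ z' → z ∈ l → z' ∈ l →
  ¬ T (p z) → ¬ T (p z') → 2 + countTrue p l ≤ length l
count-miss₂ p ne (here refl) (here refl) ¬t ¬t' = contradiction refl ne
count-miss₂ p {x ∷ l} ne (here refl) (there m) ¬t ¬t' with p x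
... | true = contradiction _ ¬t
... | false = s≤s (count-miss p m ¬t')
count-miss₂ p {x ∷ l} ne (there m) (here refl) ¬t ¬t' with p x
... | true = contradiction _ ¬t'
... | false = s≤s (count-miss p m ¬t)
count-miss₂ p {x ∷ l} ne (there m) (there m') ¬t ¬t' with p x
... | true = s≤s (count-miss₂ p ne m m' ¬t ¬t')
... | false = ℕ.m≤n⇒m≤1+n (count-miss₂ p ne m m' ¬t ¬t')

count-++ : ∀ {A : Set} (p : A → Bool) l m → countTrue p (l ++ m) ≡ countTrue p l + countTrue p m
count-++ p [] m = refl
count-++ p (x ∷ l) m with p x
... | true = cong suc (count-++ p l m)
... | false = count-++ p l m

count-map : ∀ {A B : Set} (p : B → Bool) (f : A → B) l → countTrue p (map f l) ≡ countTrue (p ∘ f) l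
count-map p f [] = refl
count-map p f (x ∷ l) with p (f x)
... | true = cong suc (count-map p f l)
... | false = count-map p f l

count-vertices : ∀ {a} (p : Vertex a → Bool) →
  countTrue p (vertices a) ≡ countTrue (p ∘ inj₁) (allFin a) + countTrue (p ∘ inj₂) (allFin a)
count-vertices {a} p = trans (count-++ p (map inj₁ (allFin a)) _)
  (cong₂ _+_ (count-map p inj₁ (allFin a)) (count-map p inj₂ (allFin a)))

count-vertices₁ : ∀ {a} (p : Vertex a → Bool) → (∀ i → p (inj₂ i) ≡ false) →
  countTrue p (vertices a) ≡ countTrue (p ∘ inj₁) (allFin a)
count-vertices₁ {a} p h = trans (count-vertices p)
  (trans (cong (countTrue (p ∘ inj₁) (allFin a) +_) (zeros (allFin a))) (ℕ.+-identityʳ _))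
  where
  zeros : ∀ l → countTrue (p ∘ inj₂) l ≡ 0
  zeros [] = refl
  zeros (x ∷ l) rewrite h x = zeros l

count-vertices₂ : ∀ {a} (p : Vertex a → Bool) → (∀ i → p (inj₁ i) ≡ false) →
  countTrue p (vertices a) ≡ countTrue (p ∘ inj₂) (allFin a)
count-vertices₂ {a} p h = trans (count-vertices p)
  (cong (_+ countTrue (p ∘ inj₂) (allFin a)) (zeros (allFin a)))
  where
  zeros : ∀ l → countTrue (p ∘ inj₁) l ≡ 0
  zeros [] = refl
  zeros (x ∷ l) rewrite h x = zeros l

saturated : ∀ {a} (P Q : Fin a → Fin a → Bool) x →
  a + a ∸ 1 ≤ countTrue (P x) (allFin a) + countTrue (λ y → Q y x) (allFin a) → Saturated P Q x
saturated {a} P Q x big = record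
  { out-out = λ {y} {y'} ¬p ne → stable λ ¬p' → missing≤1
      (ℕ.+-mono-≤ (count-miss₂ (P x) ne (∈-allFin y') (∈-allFin y) ¬p' ¬p) (count≤ inArc all))
  ; out-in = λ {y} {y'} ¬p → stable λ ¬q → missing≤1 (two
      (count-miss (P x) (∈-allFin y) ¬p) (count-miss inArc (∈-allFin y') ¬q))
  ; in-in = λ {y} {y'} ¬q ne → stable λ ¬q' → missing≤1
      (subst (_≤ length all + length all) (trans (ℕ.+-suc o (suc i)) (cong suc (ℕ.+-suc o i)))
        (ℕ.+-mono-≤ (count≤ (P x) all) (count-miss₂ inArc ne (∈-allFin y') (∈-allFin y) ¬q' ¬q)))
  ; in-out = λ {y} {y'} ¬q → stable λ ¬p → missing≤1 (two
      (count-miss (P x) (∈-allFin y') ¬p) (count-miss inArc (∈-allFin y) ¬q)) }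
  where
  all : List (Fin a)
  all = allFin a
  inArc : Fin a → Bool
  inArc y = Q y x
  o i : ℕ
  o = countTrue (P x) all
  i = countTrue inArc all
  stable : ∀ {b} → ¬ ¬ T b → T b
  stable {b} = decidable-stable (T? b)
  two : suc o ≤ length all → suc i ≤ length all → 2 + (o + i) ≤ length all + length all
  two p q = subst (_≤ length all + length all) (cong suc (ℕ.+-suc o i)) (ℕ.+-mono-≤ p q)
  missing≤1 : ¬ (2 + (o + i) ≤ length all + length all)
  -- Two missing arcs leave degree at most 2a - 2. The truncated `a + a ∸ 1` is handled by
  -- `m≤n+m∸n`.
  missing≤1 le rewrite length-tabulate {n = a} id = ℕ.<-irrefl refl
    (ℕ.≤-trans le (ℕ.≤-trans (ℕ.m≤n+m∸n (a + a) 1) (s≤s big)))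

-- From the digraph to the abstract setting.

module Digraph {a} (D : BipDigraph a) (strong : StronglyConnected D) (4≤a : 4 ≤ a)
  (dominated : (x y w : Vertex a) → ¬ (x ≡ y) → Arc D x w → Arc D y w → (a + a) ∸ 1 ≤ deg D x ⊔ deg D y)
  where

  Big : Vertex a → Set
  Big v = a + a ∸ 1 ≤ deg D v

  big⊎big : ∀ {u v w} → u ≢ v → Arc D u w → Arc D v w → Big u ⊎ Big v
  big⊎big {u} {v} {w} ne p q with ℕ.⊔-sel (deg D u) (deg D v) | dominated u v w ne p q
  ... | inj₁ e | le = inj₁ (subst (a + a ∸ 1 ≤_) e le)
  ... | inj₂ e | le = inj₂ (subst (a + a ∸ 1 ≤_) e le)

  -- Strong connectivity is applied to cuts: the complement of one vertex yields predecessors, a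
  -- pair and its complement yield `escape` and `enter`.
  crossing : ∀ {S : Vertex a → Set} → Decidable S → ∀ {u v} → Walk D u v → S u → ¬ S v →
    ∃₂ λ s t → S s × ¬ S t × Arc D s t
  crossing S? here su ¬sv = contradiction su ¬sv
  crossing S? (step {w = w} p walk) su ¬sv with S? w
  ... | yes sw = crossing S? walk sw ¬sv
  ... | no ¬sw = _ , w , su , ¬sw , p

  _≟ᵛ_ : (u v : Vertex a) → Dec (u ≡ v)
  _≟ᵛ_ = ≡-dec _≟_ _≟_

  successor : ∀ u {v} → u ≢ v → ∃ λ w → Arc D u w
  successor u {v} ne with strong u v
  ... | here = contradiction refl ne
  ... | step p _ = _ , p

  predecessor : ∀ u {v} → u ≢ v → ∃ λ w → Arc D w v
  predecessor u {v} ne with crossing (λ w → ¬? (w ≟ᵛ v)) (strong u v) ne (λ n → n refl)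
  ... | s , t , _ , ¬¬e , p with decidable-stable (t ≟ᵛ v) ¬¬e
  ... | refl = s , p

  config : Config a
  config = record
    { P = xy D ; Q = yx D ; BX = Big ∘ inj₁ ; BY = Big ∘ inj₂
    ; BX? = λ x → _ ≤? _ ; BY? = λ y → _ ≤? _ ; 4≤a = 4≤a
    ; satX = λ {x} b → saturated (xy D) (yx D) x
        (subst (a + a ∸ 1 ≤_) (cong₂ _+_ (count-vertices₂ (arcB D (inj₁ x)) λ _ → refl)
          (count-vertices₂ (λ v → arcB D v (inj₁ x)) λ _ → refl)) b)
    ; satY = λ {y} b → saturated (yx D) (xy D) y
        (subst (a + a ∸ 1 ≤_) (cong₂ _+_ (count-vertices₁ (arcB D (inj₂ y)) λ _ → refl)
          (count-vertices₁ (λ v → arcB D v (inj₂ y)) λ _ → refl)) b)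
    ; domX = λ {x} {x'} {y} ne p q →
        big⊎big {inj₁ x} {inj₁ x'} {inj₂ y} (λ e → ne (inj₁-injective e)) p q
    ; domY = λ {y} {y'} {x} ne p q →
        big⊎big {inj₂ y} {inj₂ y'} {inj₁ x} (λ e → ne (inj₂-injective e)) p q
    ; outX = outX ; inX = inX ; outY = outY ; inY = inY
    ; escape = escape ; enter = enter }
    where
    outX : ∀ x → ∃ λ y → T (xy D x y)
    outX x with successor (inj₁ x) {inj₂ x} (λ ())
    ... | inj₂ y , p = y , p
    inX : ∀ x → ∃ λ y → T (yx D y x)
    inX x with predecessor (inj₂ x) {inj₁ x} (λ ())
    ... | inj₂ y , p = y , p
    outY : ∀ y → ∃ λ x → T (yx D y x)
    outY y with successor (inj₂ y) {inj₁ y} (λ ())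
    ... | inj₁ x , p = x , p
    inY : ∀ y → ∃ λ x → T (xy D x y)
    inY y with predecessor (inj₁ y) {inj₂ y} (λ ())
    ... | inj₁ x , p = x , p
    In : Fin a → Fin a → Vertex a → Set
    In x y v = v ≡ inj₁ x ⊎ v ≡ inj₂ y
    In? : ∀ x y → Decidable (In x y)
    In? x y v = (v ≟ᵛ inj₁ x) ⊎-dec (v ≟ᵛ inj₂ y)
    outside : ∀ x y → ∃ λ v → ¬ In x y v
    outside x y with fresh (x ∷ []) (ℕ.≤-trans (s≤s (s≤s z≤n)) 4≤a)
    ... | x' , x'∉ = inj₁ x' , λ { (inj₁ refl) → x'∉ (here refl) ; (inj₂ ()) }
    escape : ∀ x y → (∃ λ x' → x' ≢ x × T (yx D y x')) ⊎ (∃ λ y' → y' ≢ y × T (xy D x y'))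
    escape x y with crossing (In? x y) (strong (inj₁ x) (proj₁ (outside x y)))
      (inj₁ refl) (proj₂ (outside x y))
    ... | .(inj₁ x) , inj₂ y' , inj₁ refl , n , p = inj₂ (y' , (λ e → n (inj₂ (cong inj₂ e))) , p)
    ... | .(inj₂ y) , inj₁ x' , inj₂ refl , n , p = inj₁ (x' , (λ e → n (inj₁ (cong inj₁ e))) , p)
    ... | .(inj₁ x) , inj₁ _ , inj₁ refl , _ , ()
    ... | .(inj₂ y) , inj₂ _ , inj₂ refl , _ , ()
    enter : ∀ x y → (∃ λ x' → x' ≢ x × T (xy D x' y)) ⊎ (∃ λ y' → y' ≢ y × T (yx D y' x))
    enter x y with crossing (λ v → ¬? (In? x y v)) (strong (proj₁ (outside x y)) (inj₁ x))
      (proj₂ (outside x y)) (λ n → n (inj₁ refl))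
    ... | s , t , n , ¬¬m , p with decidable-stable (In? x y t) ¬¬m
    enter x y | inj₁ x' , t , n , ¬¬m , p | inj₂ refl = inj₁ (x' , (λ e → n (inj₁ (cong inj₁ e))) , p)
    enter x y | inj₂ y' , t , n , ¬¬m , p | inj₁ refl = inj₂ (y' , (λ e → n (inj₂ (cong inj₂ e))) , p)

-- Without big vertices in Y, no two of them share an out-neighbour, so each `x` has in-degree one;
-- as `a ≥ 3`, it misses two in-arcs and is not saturated.
allSmall : ∀ {a} (I : Config a) → let open Config I in ¬ ∃ BY → ¬ ∃ BX
allSmall I ¬bigY (x , bx) with inX x
  where open Config I
... | y₁ , p with fresh (y₁ ∷ []) (ℕ.≤-trans (s≤s (s≤s z≤n)) (Config.4≤a I))
... | y₂ , y₂∉ with fresh (y₁ ∷ y₂ ∷ []) (ℕ.≤-trans (s≤s (s≤s (s≤s z≤n))) (Config.4≤a I))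
... | y₃ , y₃∉ = unique (λ e → y₃∉ (here e))
    (in-in (satX bx) (unique (λ e → y₂∉ (here e))) (λ e → y₃∉ (there (here e))))
  where
  open Config I
  unique : ∀ {y} → y ≢ y₁ → ¬ y ⟿ x
  unique ne q = [ (λ b → ¬bigY (_ , b)) , (λ b → ¬bigY (_ , b)) ]′ (domY ne q p)

-- Building Hamiltonian cycles.

injective⇒surjective : ∀ {n} (f : Fin n → Fin n) → (∀ {i j} → f i ≡ f j → i ≡ j) → ∀ i → ∃ λ j → i ≡ f j
injective⇒surjective f inj i =
  ∈-tabulate⁻ (full (tabulate⁺ inj) (length-tabulate f) i)

toFin : ∀ {a} → Vertex a → Fin (a + a)
toFin {a} = join a a

toFin-injective : ∀ {a} {u v : Vertex a} → toFin u ≡ toFin v → u ≡ v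
toFin-injective {a} {u} {v} e =
  trans (sym (splitAt-join a a u)) (trans (cong (splitAt a) e) (splitAt-join a a v))

fromFin : ∀ {a} → Fin (a + a) → Vertex a
fromFin {a} = splitAt a

fromFin-injective : ∀ {a} {i j : Fin (a + a)} → fromFin {a} i ≡ fromFin {a} j → i ≡ j
fromFin-injective {a} {i} {j} e =
  trans (sym (join-splitAt a a i)) (trans (cong (join a a) e) (join-splitAt a a j))

vertexEndo-surjective : ∀ {a} (f : Vertex a → Vertex a) → (∀ {u v} → f u ≡ f v → u ≡ v) →
  ∀ v → ∃ λ u → v ≡ f u
vertexEndo-surjective {a} f inj v
  with injective⇒surjective (toFin ∘ f ∘ fromFin {a})
    (fromFin-injective {a} ∘ inj ∘ toFin-injective) (toFin v)
... | j , e = _ , toFin-injective e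

next-toℕ : ∀ {n} (i : Fin n) →
  toℕ (next i) ≡ suc (toℕ i) ⊎ suc (toℕ i) ≡ n × toℕ (next i) ≡ 0
next-toℕ {suc n} i with ℕ.m≤n⇒m<n∨m≡n (toℕ<n i)
... | inj₁ lt = inj₁ (trans (toℕ-fromℕ< _) (m<n⇒m%n≡m lt))
... | inj₂ e = inj₂ (e , trans (toℕ-fromℕ< _) (trans (cong (_% suc n) e) (n%n≡0 (suc n))))

-- A section `pos` of `c` is injective, hence by counting a two-sided inverse. Keeping `n` apart
-- from `a + a` lets it be a list length or an orbit period.
hamiltonian : ∀ {a} (D : BipDigraph a) {n} → n ≡ a + a →
  (c : Fin n → Vertex a) (pos : Vertex a → Fin n) →
  (∀ v → c (pos v) ≡ v) → (∀ i → Arc D (c i) (c (next i))) → Hamiltonian D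
hamiltonian {a} D refl c pos c-pos arc = mk↔ₛ′ c pos c-pos pos-c , arc
  where
  pos-injective : ∀ {u v} → pos u ≡ pos v → u ≡ v
  pos-injective {u} {v} e = trans (sym (c-pos u)) (trans (cong c e) (c-pos v))
  pos-c : ∀ i → pos (c i) ≡ i
  pos-c i with injective⇒surjective (pos ∘ fromFin {a}) (fromFin-injective {a} ∘ pos-injective) i
  ... | j , refl = cong pos (c-pos _)

module _ {a} (D : BipDigraph a) where

  ClosedWalk : Vertex a → List (Vertex a) → Set
  ClosedWalk z [] = ⊥
  ClosedWalk z (u ∷ []) = Arc D u z
  ClosedWalk z (u ∷ l@(v ∷ _)) = Arc D u v × ClosedWalk z l

  walk-step : ∀ {z} l → ClosedWalk z l → ∀ i j → toℕ j ≡ suc (toℕ i) → Arc D (lookup l i) (lookup l j)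
  walk-step (u ∷ v ∷ l) (p , w) zero (suc zero) e = p
  walk-step (u ∷ v ∷ l) (p , w) (suc i) (suc j) e = walk-step (v ∷ l) w i j (ℕ.suc-injective e)

  walk-close : ∀ {z} l → ClosedWalk z l → ∀ i → suc (toℕ i) ≡ length l → Arc D (lookup l i) z
  walk-close (u ∷ []) p zero e = p
  walk-close (u ∷ v ∷ l) (p , w) (suc i) e = walk-close (v ∷ l) w i (ℕ.suc-injective e)

  hamiltonian-list : ∀ z l → length (z ∷ l) ≡ a + a → ClosedWalk z (z ∷ l) →
    (∀ v → v ∈ z ∷ l) → Hamiltonian D
  hamiltonian-list z l size walk all = hamiltonian D size (lookup (z ∷ l)) (λ v → index (all v))
    (λ v → sym (lookup-index (all v))) arc
    where
    at-zero : ∀ j → toℕ j ≡ 0 → lookup (z ∷ l) j ≡ z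
    at-zero zero _ = refl
    arc : ∀ i → Arc D (lookup (z ∷ l) i) (lookup (z ∷ l) (next i))
    arc i with next-toℕ i
    ... | inj₁ e = walk-step (z ∷ l) walk i (next i) e
    ... | inj₂ (e , e') = subst (Arc D (lookup (z ∷ l) i)) (sym (at-zero (next i) e'))
          (walk-close (z ∷ l) walk i e)

  module _ (I : Config a) (f g : Fin a → Vertex a)
    (f⟶g : ∀ {x y} → Config._⟶_ I x y → Arc D (f x) (g y))
    (g⟿f : ∀ {x y} → Config._⟿_ I y x → Arc D (g y) (f x))
    (onto : ∀ v → (∃ λ x → v ≡ f x) ⊎ (∃ λ y → v ≡ g y)) where

    flatten : List (Fin a × Fin a) → List (Vertex a)
    flatten [] = []
    flatten ((x , y) ∷ l) = f x ∷ g y ∷ flatten l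

    flatten-closed : ∀ z l → Closed I z l → ClosedWalk (f z) (flatten l)
    flatten-closed z ((x , y) ∷ []) (p , q) = f⟶g p , g⟿f q
    flatten-closed z ((x , y) ∷ l@(_ ∷ _)) (p , q , r) = f⟶g p , g⟿f q , flatten-closed z l r

    flatten-length : ∀ l → length (flatten l) ≡ length l + length l
    flatten-length [] = refl
    flatten-length (_ ∷ l) = cong suc
      (trans (cong suc (flatten-length l)) (sym (ℕ.+-suc (length l) (length l))))

    ∈-flatten₁ : ∀ {x} l → x ∈ map proj₁ l → f x ∈ flatten l
    ∈-flatten₁ (_ ∷ l) (here refl) = here refl
    ∈-flatten₁ (_ ∷ l) (there m) = there (there (∈-flatten₁ l m))

    ∈-flatten₂ : ∀ {y} l → y ∈ map proj₂ l → g y ∈ flatten l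
    ∈-flatten₂ (_ ∷ l) (here refl) = there (here refl)
    ∈-flatten₂ (_ ∷ l) (there m) = there (there (∈-flatten₂ l m))

    -- With the embeddings `f` and `g` of the sides left free, one conversion serves both a
    -- configuration and its dual.
    cover⇒hamiltonian : Cover I → Hamiltonian D
    cover⇒hamiltonian c = hamiltonian-list (f x₁) (g y₁ ∷ flatten ((x₂ , y₂) ∷ rest))
      (trans (flatten-length arcs) (cong₂ _+_ size size)) (flatten-closed x₁ arcs closed) member
      where
      open Cycle (spanning I c)
      member : ∀ v → v ∈ flatten arcs
      member v with onto v
      ... | inj₁ (x , refl) = ∈-flatten₁ arcs (full uniqueX (trans (length-map proj₁ arcs) size) x)
      ... | inj₂ (y , refl) = ∈-flatten₂ arcs (full uniqueY (trans (length-map proj₂ arcs) size) y)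

  -- If in-neighbours are unique, so are out-neighbours, and strong connectivity makes the
  -- successor permutation a single orbit.
  module _ (strong : StronglyConnected D) (unique-in : ∀ u v w → Arc D u w → Arc D v w → u ≡ v)
    (s : Vertex a → Vertex a) (s-arc : ∀ v → Arc D v (s v)) (u₀ : Vertex a) where

    s-injective : ∀ {u v} → s u ≡ s v → u ≡ v
    s-injective {u} {v} e = unique-in u v (s u) (s-arc u) (subst (Arc D v) (sym e) (s-arc v))

    -- An injective `s` on a finite set is onto, so `w` is some `s v`, and uniqueness of
    -- in-neighbours gives `v = u`.
    arc⇒s : ∀ u w → Arc D u w → w ≡ s u
    arc⇒s u w p with vertexEndo-surjective s s-injective w
    ... | v , refl = cong s (unique-in v u (s v) (s-arc v) p)

    orbit : ∀ {v} m → Walk D (fold u₀ s m) v → ∃ λ k → fold u₀ s k ≡ v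
    orbit m here = m , refl
    orbit m (step {w = v} p w) with arc⇒s (fold u₀ s m) v p
    ... | refl = orbit (suc m) w

    fold-cancel : ∀ {z v} m → fold z s m ≡ fold v s m → z ≡ v
    fold-cancel zero e = e
    fold-cancel (suc m) e = fold-cancel m (s-injective e)

    -- Two of the first 2a + 1 iterates coincide; cancelling the common initial steps brings the
    -- repetition back to `u₀`.
    period : ∃ λ d → suc d ≤ a + a × fold u₀ s (suc d) ≡ u₀
    period with pigeonhole (ℕ.n<1+n (a + a)) (λ i → toFin (fold u₀ s (toℕ i)))
    ... | i , j , i<j , e with ℕ.m≤n⇒∃[o]m+o≡n i<j
    ... | d , e' =
      d , ℕ.≤-trans (ℕ.m≤n+m (suc d) (toℕ i))
            (subst (_≤ a + a) (sym i+d≡j) (ℕ.≤-pred (toℕ<n j))) ,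
      sym (fold-cancel (toℕ i) (trans (toFin-injective e)
        (trans (cong (fold u₀ s) (sym i+d≡j)) (fold-+ u₀ s (toℕ i)))))
      where
      i+d≡j : toℕ i + suc d ≡ toℕ j
      i+d≡j = trans (ℕ.+-suc (toℕ i) d) e'

    hamiltonian-orbit : Hamiltonian D
    hamiltonian-orbit with period
    ... | d , d<2a , e = hamiltonian D
        -- The period is at most 2a by the pigeonhole principle and at least 2a because `pos` is
        -- injective on the vertices.
        (ℕ.≤-antisym d<2a (injective⇒≤ (fromFin-injective {a} ∘ pos-injective))) c pos c-pos arc
      where
      n = suc d
      c : Fin n → Vertex a
      c i = fold u₀ s (toℕ i)
      multiple : ∀ q → fold u₀ s (q * n) ≡ u₀
      multiple zero = refl
      multiple (suc q) = trans (fold-+ u₀ s n) (trans (cong (λ z → fold z s n) (multiple q)) e)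
      reduce : ∀ k → fold u₀ s (k % n) ≡ fold u₀ s k
      reduce k = sym (trans (cong (fold u₀ s) (m≡m%n+[m/n]*n k n))
        (trans (fold-+ u₀ s (k % n)) (cong (λ z → fold z s (k % n)) (multiple (k / n)))))
      time : ∀ v → ∃ λ k → fold u₀ s k ≡ v
      time v = orbit 0 (strong u₀ v)
      pos : Vertex a → Fin n
      pos v = fromℕ< (m%n<n (proj₁ (time v)) n)
      c-pos : ∀ v → c (pos v) ≡ v
      c-pos v = trans (cong (fold u₀ s) (toℕ-fromℕ< (m%n<n (proj₁ (time v)) n)))
        (trans (reduce (proj₁ (time v))) (proj₂ (time v)))
      pos-injective : ∀ {u v} → pos u ≡ pos v → u ≡ v
      pos-injective {u} {v} e' = trans (sym (c-pos u)) (trans (cong c e') (c-pos v))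
      arc : ∀ i → Arc D (c i) (c (next i))
      arc i with next-toℕ i
      ... | inj₁ e' = subst (λ k → Arc D (c i) (fold u₀ s k)) (sym e') (s-arc (c i))
      ... | inj₂ (l , e') = subst (λ k → Arc D (c i) (fold u₀ s k)) (sym e')
            (subst (Arc D (c i)) (trans (cong (fold u₀ s) l) e) (s-arc (c i)))

-- Recognising D(8) and the final case split.

D8Labelling⇒Isomorphic : ∀ {a} (D : BipDigraph a) (I : Config a) →
  (∀ x y → xy D x y ≡ Config.P I x y) → (∀ y x → yx D y x ≡ Config.Q I y x) →
  D8Labelling I → Isomorphic D D8
D8Labelling⇒Isomorphic D I eP eQ (ξ , η , xy-arcs , yx-arcs) = ↔-sym (ξ ⊎-↔ η) , same
  where
  open Inverse
  same : ∀ u v → arcB D u v ≡ arcB D8 (from (ξ ⊎-↔ η) u) (from (ξ ⊎-↔ η) v)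
  same (inj₁ x) (inj₁ x') = refl
  same (inj₂ y) (inj₂ y') = refl
  same (inj₁ x) (inj₂ y) = trans (eP x y) (trans
    (sym (cong₂ (Config.P I) (inverseˡ ξ refl) (inverseˡ η refl))) (xy-arcs (from ξ x) (from η y)))
  same (inj₂ y) (inj₁ x) = trans (eQ y x) (trans
    (sym (cong₂ (Config.Q I) (inverseˡ η refl) (inverseˡ ξ refl))) (yx-arcs (from η y) (from ξ x)))

theorem1p9 : (a : ℕ) → 8 ≤ a + a → (D : BipDigraph a) → StronglyConnected D →
    ((x y w : Vertex a) → ¬ (x ≡ y) → Arc D x w → Arc D y w →
    (a + a) ∸ 1 ≤ deg D x ⊔ deg D y) →
    ¬ Isomorphic D D8 → Hamiltonian D
theorem1p9 a 8≤2a D strong dominated ¬D8 = go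
  where
  4≤a : 4 ≤ a
  4≤a = ℕ.≮⇒≥ λ a<4 → ℕ.<-irrefl refl (ℕ.≤-trans (s≤s (ℕ.+-mono-≤ (ℕ.≤-pred a<4) (ℕ.≤-pred a<4)))
    (ℕ.≤-trans (ℕ.n≤1+n 7) 8≤2a))
  open Digraph D strong 4≤a dominated

  xy-onto : ∀ (v : Vertex a) → (∃ λ x → v ≡ inj₁ x) ⊎ (∃ λ y → v ≡ inj₂ y)
  xy-onto (inj₁ x) = inj₁ (x , refl)
  xy-onto (inj₂ y) = inj₂ (y , refl)

  yx-onto : ∀ (v : Vertex a) → (∃ λ y → v ≡ inj₂ y) ⊎ (∃ λ x → v ≡ inj₁ x)
  yx-onto v = [ inj₂ , inj₁ ]′ (xy-onto v)

  directed : ¬ ∃ (Big ∘ inj₁) → ¬ ∃ (Big ∘ inj₂) → Hamiltonian D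
  directed noX noY = hamiltonian-orbit D strong unique-in (proj₁ ∘ out) (proj₂ ∘ out)
    (inj₁ (proj₁ (fresh [] (ℕ.≤-trans (s≤s z≤n) 4≤a))))
    where
    small : ∀ v → ¬ Big v
    small (inj₁ x) b = noX (x , b)
    small (inj₂ y) b = noY (y , b)
    unique-in : ∀ u v w → Arc D u w → Arc D v w → u ≡ v
    unique-in u v w p q = decidable-stable (u ≟ᵛ v) λ ne →
      [ small u , small v ]′ (big⊎big {w = w} ne p q)
    out : ∀ v → ∃ λ w → Arc D v w
    out (inj₁ x) = successor (inj₁ x) {inj₂ x} λ ()
    out (inj₂ y) = successor (inj₂ y) {inj₁ y} λ ()

  go : Hamiltonian D
  go with any? (Config.BX? config) | any? (Config.BY? config)
  -- If one side has no big vertex, neither has the other, and the directed-cycle case applies.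
  ... | _ | no noY = directed (allSmall config noY) noY
  ... | no noX | yes _ = directed noX (allSmall (dual config) noX)
  ... | yes bx | yes by with coverOrDual config bx by
        (λ l → ¬D8 (D8Labelling⇒Isomorphic D config (λ _ _ → refl) (λ _ _ → refl) l))
  ...   | inj₁ c = cover⇒hamiltonian D config inj₁ inj₂ id id xy-onto c
  ...   | inj₂ c = cover⇒hamiltonian D (dual config) inj₂ inj₁ id id yx-onto c
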